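{- For all integers $1\le k\le n$, $$V_{n,k}(t)=\sum_{[\sigma]\in\mathcal{FL}^{(B)}_{n,n-k+1}}t^{\,n+1-2\cdot\mathsf{spk}([\sigma])}\qquad\text{and}\qquad V_{n,-k}(t)=\sum_{[\sigma]\in\mathcal{FL}^{(D)}_{n,n-k+1}}t^{\,n+1-2\cdot \mathsf{spk}([\sigma])}.$$
   Context: Arnold–Hoffman polynomials: for integers $1\le |k|\le n$ define $V_{n,k}(t)$ by $V_{1,1}=t^2$, $V_{1,-1}=1$, $V_{n,-n}=0$ for $n\ge 2$, and $V_{n,-k}=V_{n,-k-1}+t^{ -1}V_{n-1,k}$ for $n>k\ge 1$; $V_{n,1}=t^2V_{n,-1}$ for $n\ge2$; $V_{n,k}=V_{n,k-1}+tV_{n-1,-k+1}$ for $n\ge k>1$. Signed permutations of $[n]$ are written in window notation $\sigma=\sigma_1\cdots\sigma_n$ (entries in $\{\pm1,\dots,\pm n\}$ with $|\sigma_1|,\dots,|\sigma_n|$ a permutation of $[n]$); $\bar a=-a$. For $1\le k\le n$, $\sigma_k\cdots\sigma_1\sigma_{k+1}\cdots\sigma_n$ is a flip of $\sigma$ if $k=n$ or $|\sigma_{k+1}|<\min\{|\sigma_i|:1\le i\le k\}$. Flip equivalence is the equivalence relation generated by flips; $[\sigma]$ is the class of $\sigma$. Signed maximum: for a nonempty word $\sigma$ of nonzero integers with distinct absolute values, write $\sigma=\sigma_L\hat\sigma\sigma_R$ with $|\hat\sigma|=\min|\sigma|$, and define recursively: (1) if $\sigma_L,\sigma_R$ are empty,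 $\mathsf{smax}(\sigma)=\hat\sigma$; (2) if $\sigma_L$ empty, $\sigma_R$ nonempty: $\mathsf{smax}(\sigma)=\hat\sigma$ if $\hat\sigma>0$, and $=\mathsf{smax}(\sigma_R)$ if $\hat\sigma<0$; (3) if $\sigma_L$ nonempty, $\sigma_R$ empty: $\mathsf{smax}(\sigma)=\hat\sigma$ if $\hat\sigma>0$, and $=\mathsf{smax}(\sigma_L)$ if $\hat\sigma<0$; (4) if both nonempty and $\hat\sigma>0$: $\mathsf{smax}(\sigma)=\mathsf{smax}(\sigma_L)$ if $\min|\sigma_L|>\min|\sigma_R|$ and $=\mathsf{smax}(\sigma_R)$ if $\min|\sigma_L|<\min|\sigma_R|$; (5) if both nonempty and $\hat\sigma<0$: $\mathsf{smax}(\sigma)=\mathsf{smax}(\sigma_L)$ if $\min|\sigma_L|<\min|\sigma_R|$ and $=\mathsf{smax}(\sigma_R)$ if $\min|\sigma_L|>\min|\sigma_R|$. This value is constant on flip classes; set $\mathsf{smax}([\sigma])=\mathsf{smax}(\sigma)$. $\mathcal{FL}^{(B)}_{n,k}$ is the set of flip classes of signed permutations of $[n]$ with $\mathsf{smax}=k$, and $\mathcal{FL}^{(D)}_{n,k}$ the set of those with $\mathsf{smax}=-k$. Signed peak: $\mathsf{spk}(\sigma)=\#\{i: 1\le i\le n,\ \sigma_i<0,\ |\sigma_{i-1}|<|\sigma_i|>|\sigma_{i+1}|\}$ with $\sigma_0=\sigma_{n+1}=0$; it is constant on flip classes, and $\mathsf{spk}([\sigma])=\mathsf{spk}(\sigma)$.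 -}

module Defs where

open import Data.Nat as ℕ using (ℕ; zero; suc; _∸_; _⊓_)
open import Data.Integer as ℤ using (ℤ; +_; -[1+_]; ∣_∣)
open import Data.Bool using (Bool; true; false; if_then_else_; _∧_)
open import Data.List using (List; []; _∷_; _++_; map; length; take; drop; reverse; upTo; foldr; filter)
open import Data.List.Relation.Unary.All using (All)
open import Data.List.Relation.Unary.AllPairs using (AllPairs)
open import Data.List.Membership.Propositional using (_∈_)
open import Data.List.Relation.Binary.Permutation.Propositional using (_↭_)
open import Data.Product using (_×_; _,_; ∃; ∃-syntax)
open import Data.Sum using (_⊎_)
open import Data.Maybe using (Maybe; just; nothing)
open import Relation.Nullary using (¬_; does)
open import Relation.Binary.PropositionalEquality using (_≡_)
open import Relation.Binary.Construct.Closure.Equivalence using (EqClosure)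

-- Laurent polynomials in t with natural-number coefficients,
-- represented by their coefficient function (exponent ↦ coefficient).
-- (All polynomials in the statement have nonnegative coefficients.)

Laurent : Set
Laurent = ℤ → ℕ

_≈L_ : Laurent → Laurent → Set
p ≈L q = ∀ e → p e ≡ q e

0L : Laurent
0L _ = 0

_+L_ : Laurent → Laurent → Laurent
(p +L q) e = p e ℕ.+ q e

mono : ℤ → Laurent
mono a e = if does (e ℤ.≟ a) then 1 else 0

_·L_ : ℤ → Laurent → Laurent
(a ·L p) e = p (e ℤ.- a)

1L : Laurent
1L = mono (+ 0)

-- Arnold–Hoffman polynomials.
-- VP n k = V_{n,k},  VN n k = V_{n,-k}   (meaningful for 1 ≤ k ≤ n).
-- VNd p d = V_{p+1, -(p+1-d)}, computed by the recurrence
--   V_{n,-n} = 0 (n ≥ 2),  V_{n,-k} = V_{n,-k-1} + t^{-1} V_{n-1,k}.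

mutual
  VP : ℕ → ℕ → Laurent
  VP zero _ = 0L
  VP (suc zero) (suc zero) = mono (+ 2)
  VP (suc zero) _ = 0L
  VP (suc (suc m)) zero = 0L
  VP (suc (suc m)) (suc zero) = (+ 2) ·L VN (suc (suc m)) 1
  VP (suc (suc m)) (suc (suc j)) =
    VP (suc (suc m)) (suc j) +L ((+ 1) ·L VN (suc m) (suc j))

  VN : ℕ → ℕ → Laurent
  VN zero _ = 0L
  VN (suc zero) (suc zero) = 1L
  VN (suc zero) _ = 0L
  VN (suc (suc m)) k = VNd (suc m) (suc (suc m) ∸ k)

  VNd : ℕ → ℕ → Laurent
  VNd p zero = 0L
  VNd p (suc d) = VNd p d +L ((ℤ.- (+ 1)) ·L VP p (suc p ∸ suc d))

-- V n k for an integer index k (V_{n,k}); V_{n,0} is never used.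
V : ℕ → ℤ → Laurent
V n (+ k) = VP n k
V n -[1+ k ] = VN n (suc k)

SignedPerm : ℕ → List ℤ → Set
SignedPerm n σ = map ∣_∣ σ ↭ map suc (upTo n)

Flip : List ℤ → List ℤ → Set
Flip σ τ = ∃[ k ] (1 ℕ.≤ k × k ℕ.≤ length σ
  × (k ≡ length σ
     ⊎ ∃[ x ] ∃[ rest ] (drop k σ ≡ x ∷ rest
                          × All (λ y → ∣ x ∣ ℕ.< ∣ y ∣) (take k σ)))
  × τ ≡ reverse (take k σ) ++ drop k σ)

FlipEq : List ℤ → List ℤ → Set
FlipEq = EqClosure Flip

minAbs : List ℤ → ℕ
minAbs [] = 0
minAbs (x ∷ xs) = foldr (λ y m → ∣ y ∣ ⊓ m) ∣ x ∣ xs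

splitAt≡ : ℕ → List ℤ → Maybe (List ℤ × ℤ × List ℤ)
splitAt≡ m [] = nothing
splitAt≡ m (x ∷ xs) with does (∣ x ∣ ℕ.≟ m) | splitAt≡ m xs
... | true  | _ = just ([] , x , xs)
... | false | nothing = nothing
... | false | just (L , y , R) = just (x ∷ L , y , R)

splitMin : List ℤ → Maybe (List ℤ × ℤ × List ℤ)
splitMin σ = splitAt≡ (minAbs σ) σ

isPos : ℤ → Bool
isPos (+ suc _) = true
isPos _ = false

-- fuel-bounded recursion (fuel = length suffices); value 0 on the empty word
smaxF : ℕ → List ℤ → ℤ
smaxF zero _ = + 0
smaxF (suc f) σ with splitMin σ
... | nothing = + 0
... | just ([] , x , []) = x
... | just ([] , x , R@(_ ∷ _)) = if isPos x then x else smaxF f R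
... | just (L@(_ ∷ _) , x , []) = if isPos x then x else smaxF f L
... | just (L@(_ ∷ _) , x , R@(_ ∷ _)) =
  if isPos x
  then (if does (minAbs R ℕ.<? minAbs L) then smaxF f L else smaxF f R)
  else (if does (minAbs L ℕ.<? minAbs R) then smaxF f L else smaxF f R)

smax : List ℤ → ℤ
smax σ = smaxF (length σ) σ

-- Signed peak number (σ_0 = σ_{n+1} = 0)

nextAbs : List ℤ → ℕ
nextAbs [] = 0
nextAbs (y ∷ _) = ∣ y ∣

isNeg : ℤ → Bool
isNeg -[1+ _ ] = true
isNeg _ = false

spkFrom : ℕ → List ℤ → ℕ
spkFrom prev [] = 0
spkFrom prev (x ∷ xs) =
  (if isNeg x ∧ does (prev ℕ.<? ∣ x ∣) ∧ does (nextAbs xs ℕ.<? ∣ x ∣) then 1 else 0)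
  ℕ.+ spkFrom ∣ x ∣ xs

spk : List ℤ → ℕ
spk = spkFrom 0

-- Sums over flip classes are taken over a system of representatives:
-- a list containing exactly one signed permutation from each flip class.

Transversal : ℕ → List (List ℤ) → Set
Transversal n L =
  All (SignedPerm n) L
  × (∀ σ → SignedPerm n σ → ∃[ τ ] (τ ∈ L × FlipEq σ τ))
  × AllPairs (λ σ τ → ¬ FlipEq σ τ) L

weight : ℕ → List ℤ → Laurent
weight n σ = mono (+ suc n ℤ.- + (2 ℕ.* spk σ))

classSum : ℕ → ℤ → List (List ℤ) → Laurent
classSum n s L = foldr (λ σ acc → weight n σ +L acc) 0L
                       (filter (λ σ → smax σ ℤ.≟ s) L)

{-# OPTIONS --safe #-}
module Submission where

-- Cutting a signed word at its letter of least absolute value gives a signed increasing binary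
-- tree, and flips identify the trees that differ by exchanging the two subtrees of a node. At an
-- inner node the sign and the unordered pair of subtrees carry the same information as an ordered
-- pair: put the subtree with the smaller root (an empty one counting as infinite) first if the sign
-- is negative, and second if it is positive. So a flip class is a tree whose only negative labels
-- are leaves, that is, a word in which every negative letter is a peak. In this word smax is the
-- first letter, since smax always descends into the subtree put first, and spk counts the negative
-- letters. Removing the first letter of such words yields
--   V_{q+1,j+1}    = t ( Σ_{i=1}^{q} V_{q,i} + Σ_{i=1}^{j} V_{q,-i} ),
--   V_{q+1,-(j+1)} = t⁻¹ Σ_{i=j+1}^{q} V_{q,i},
-- which are the summed forms of the defining recurrences.

open import Defs
open import Data.Nat using (ℕ; zero; suc; _≤_; _<_; _∸_; _+_; _*_; _⊓_; _<?_; _≟_; z≤n; s≤s)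
open import Data.Nat.ListAction using (sum)
open import Data.Nat.ListAction.Properties using (sum-++; sum-↭)
open import Data.Nat.Properties
open import Data.Nat.Solver using (module +-*-Solver)
import Data.Integer as ℤ
open import Data.Integer using (ℤ; +_; -_; -[1+_]; ∣_∣; _◃_)
import Data.Integer.Properties as ℤₚ
open import Data.Integer.Tactic.RingSolver using (solve-∀)
open import Data.Sign as Sign using (Sign)
open import Data.Bool using (Bool; true; false; if_then_else_; _∧_)
open import Data.Bool.Properties using (∧-zeroʳ; ∧-identityʳ)
open import Data.Maybe using (just)
open import Data.List using (List; []; _∷_; [_]; _++_; upTo; applyUpTo; filter; map; foldr; length; reverse; take; drop)
open import Data.List.Properties hiding (sum-++)
open import Data.List.Membership.Propositional using (_∈_)
open import Data.List.Membership.Propositional.Properties using (∈-map⁺; ∈-map⁻; ∈-++⁺ˡ; ∈-++⁺ʳ; ∈-++⁻; ∈-∃++; ∈-filter⁺; ∈-filter⁻)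
open import Data.List.Membership.Propositional.Properties.WithK using (unique∧set⇒bag)
open import Data.List.Relation.Unary.All as All using (All; []; _∷_)
import Data.List.Relation.Unary.All.Properties as All
open import Data.List.Relation.Unary.AllPairs as AllPairs using (AllPairs; []; _∷_)
import Data.List.Relation.Unary.AllPairs.Properties as AllPairs
open import Data.List.Relation.Unary.Any using (here; there)
open import Data.List.Relation.Unary.Unique.Propositional using (Unique)
import Data.List.Relation.Unary.Unique.Propositional.Properties as Unique
open import Data.List.Relation.Binary.BagAndSetEquality using (∼bag⇒↭)
open import Data.List.Relation.Binary.Permutation.Propositional using (_↭_; ↭-refl; ↭-sym; ↭-trans; ↭-prep; ↭-reflexive; ↭⇒↭ₛ)
import Data.List.Relation.Binary.Permutation.Propositional.Properties as Perm
import Data.List.Relation.Binary.Permutation.Setoid.Properties as PermSetoid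
open import Data.Product using (_×_; _,_; proj₁; proj₂; ∃-syntax)
open import Data.Sum using (_⊎_; inj₁; inj₂)
open import Data.Unit using (⊤; tt)
open import Data.Empty using (⊥-elim)
open import Function using (_∘_; id)
open import Function.Bundles using (mk⇔)
open import Relation.Nullary using (yes; no; does; ¬_; contradiction)
open import Relation.Nullary.Decidable using (dec-true; dec-false)
open import Relation.Binary.Construct.Closure.Equivalence as Eq using ()
open import Relation.Binary.Construct.Closure.ReflexiveTransitive using (ε; _◅_; _◅◅_)
open import Relation.Binary.Construct.Closure.Symmetric using (fwd; bwd)
open import Relation.Binary.PropositionalEquality hiding ([_])

-- Increasing binary trees

data Tree : Set where
  ∅    : Tree
  node : ℤ → Tree → Tree → Tree

inorder : Tree → List ℤ
inorder ∅            = []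
inorder (node x l r) = inorder l ++ x ∷ inorder r

-- Prepending a letter changes only the left spine: `x` passes the smaller labels and takes the
-- first larger subtree as its right subtree. The tree thus becomes a fold over the word, with no
-- search for minima.
insert : ℤ → Tree → Tree
insert x ∅            = node x ∅ ∅
insert x (node y l r) =
  if does (∣ x ∣ <? ∣ y ∣) then node x ∅ (node y l r) else node y (insert x l) r

inserts : List ℤ → Tree → Tree
inserts xs t = foldr insert t xs

build : List ℤ → Tree
build xs = inserts xs ∅

-- Only roots are compared: in a heap they are the minima of the two subtrees, which is what `smax`
-- and the canonical form compare.
Apart : Tree → Tree → Set
Apart (node x _ _) (node y _ _) = ∣ x ∣ ≢ ∣ y ∣
Apart _            _            = ⊤

data Heap : ℕ → Tree → Set where
  ∅    : ∀ {b} → Heap b ∅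
  node : ∀ {b x l r} → b < ∣ x ∣ → Heap ∣ x ∣ l → Heap ∣ x ∣ r → Apart l r → Heap b (node x l r)

Distinct : List ℤ → Set
Distinct = AllPairs (λ x y → ∣ x ∣ ≢ ∣ y ∣)

insert-< : ∀ {x y l r} → ∣ x ∣ < ∣ y ∣ → insert x (node y l r) ≡ node x ∅ (node y l r)
insert-< {x} {y} x<y rewrite dec-true (∣ x ∣ <? ∣ y ∣) x<y = refl

insert-≮ : ∀ {x y l r} → ¬ ∣ x ∣ < ∣ y ∣ → insert x (node y l r) ≡ node y (insert x l) r
insert-≮ {x} {y} x≮y rewrite dec-false (∣ x ∣ <? ∣ y ∣) x≮y = refl

inorder-insert : ∀ x t → inorder (insert x t) ≡ x ∷ inorder t
inorder-insert x ∅ = refl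
inorder-insert x (node y l r) with ∣ x ∣ <? ∣ y ∣
... | yes x<y rewrite insert-< {x} {y} {l} {r} x<y = refl
... | no  x≮y rewrite insert-≮ {x} {y} {l} {r} x≮y = cong (_++ y ∷ inorder r) (inorder-insert x l)

inorder-build : ∀ xs → inorder (build xs) ≡ xs
inorder-build []       = refl
inorder-build (x ∷ xs) = trans (inorder-insert x (build xs)) (cong (x ∷_) (inorder-build xs))

inserts-below : ∀ {xs} y l r → All (λ x → ∣ y ∣ < ∣ x ∣) xs →
                inserts xs (node y l r) ≡ node y (inserts xs l) r
inserts-below y l r []           = refl
inserts-below y l r (y<x ∷ y<xs) rewrite inserts-below y l r y<xs = insert-≮ (<⇒≯ y<x)

heap-all : ∀ {b t} → Heap b t → All (λ x → b < ∣ x ∣) (inorder t)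
heap-all ∅ = []
heap-all (node b<x hl hr _) =
  All.++⁺ (All.map (<-trans b<x) (heap-all hl)) (b<x ∷ All.map (<-trans b<x) (heap-all hr))

insert-leftmost : ∀ {x t} → Heap ∣ x ∣ t → insert x t ≡ node x ∅ t
insert-leftmost ∅                = refl
insert-leftmost (node x<y _ _ _) = insert-< x<y

-- The right part is rebuilt first, `x` lands on top of it as the smaller letter, and the left part
-- then falls entirely below `x`. With `inorder-build` this identifies words with heaps.
build-inorder : ∀ {b t} → Heap b t → build (inorder t) ≡ t
build-inorder ∅ = refl
build-inorder {t = node x l r} (node _ hl hr _) = begin
  build (inorder l ++ x ∷ inorder r)               ≡⟨ foldr-++ insert ∅ (inorder l) (x ∷ inorder r) ⟩
  inserts (inorder l) (insert x (build (inorder r))) ≡⟨ cong (inserts (inorder l) ∘ insert x) (build-inorder hr) ⟩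
  inserts (inorder l) (insert x r)                 ≡⟨ cong (inserts (inorder l)) (insert-leftmost hr) ⟩
  inserts (inorder l) (node x ∅ r)                 ≡⟨ inserts-below x ∅ r (heap-all hl) ⟩
  node x (build (inorder l)) r                     ≡⟨ cong (λ l′ → node x l′ r) (build-inorder hl) ⟩
  node x l r                                       ∎
  where open ≡-Reasoning

apart-∅ : ∀ t → Apart t ∅
apart-∅ ∅            = tt
apart-∅ (node _ _ _) = tt

-- The root of `insert x l` is either the old root of `l` or `x`; freshness of `x` settles the
-- second case.
apart-insert : ∀ {x l r} → Apart l r → All (λ y → ∣ x ∣ ≢ ∣ y ∣) (inorder r) → Apart (insert x l) r
apart-insert {x} {l} {∅} _ _ = apart-∅ (insert x l)
apart-insert {l = ∅} {node y a b} _ x∉ with All.++⁻ʳ (inorder a) x∉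
... | x≢y ∷ _ = x≢y
apart-insert {x} {node z c d} {node y a b} z≢y x∉ with ∣ x ∣ <? ∣ z ∣ | All.++⁻ʳ (inorder a) x∉
... | yes x<z | x≢y ∷ _ rewrite insert-< {x} {z} {c} {d} x<z = x≢y
... | no  x≮z | _       rewrite insert-≮ {x} {z} {c} {d} x≮z = z≢y

heap-insert : ∀ {b x t} → b < ∣ x ∣ → All (λ y → ∣ x ∣ ≢ ∣ y ∣) (inorder t) → Heap b t → Heap b (insert x t)
heap-insert b<x _ ∅ = node b<x ∅ ∅ tt
heap-insert {x = x} b<x x∉ (node {x = y} {l} {r} b<y hl hr l#r)
  with ∣ x ∣ <? ∣ y ∣ | All.++⁻ (inorder l) x∉
... | yes x<y | _ rewrite insert-< {x} {y} {l} {r} x<y = node b<x ∅ (node x<y hl hr l#r) tt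
... | no  x≮y | x∉l , x≢y ∷ x∉r rewrite insert-≮ {x} {y} {l} {r} x≮y =
  node b<y (heap-insert (≤∧≢⇒< (≮⇒≥ x≮y) (x≢y ∘ sym)) x∉l hl) hr (apart-insert {l = l} l#r x∉r)

heap-build : ∀ {b xs} → All (λ x → b < ∣ x ∣) xs → Distinct xs → Heap b (build xs)
heap-build []           []         = ∅
heap-build {xs = x ∷ xs} (b<x ∷ b<xs) (x∉ ∷ d) =
  heap-insert b<x (subst (All _) (sym (inorder-build xs)) x∉) (heap-build b<xs d)

mirror : Tree → Tree
mirror ∅            = ∅
mirror (node x l r) = node x (mirror r) (mirror l)

inorder-mirror : ∀ t → inorder (mirror t) ≡ reverse (inorder t)
inorder-mirror ∅            = refl
inorder-mirror (node x l r) = begin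
  inorder (mirror r) ++ x ∷ inorder (mirror l)      ≡⟨ cong₂ (λ a b → a ++ x ∷ b) (inorder-mirror r) (inorder-mirror l) ⟩
  reverse (inorder r) ++ x ∷ reverse (inorder l)    ≡⟨ ++-assoc (reverse (inorder r)) [ x ] _ ⟨
  (reverse (inorder r) ++ [ x ]) ++ reverse (inorder l) ≡⟨ cong (_++ reverse (inorder l)) (unfold-reverse x (inorder r)) ⟨
  reverse (x ∷ inorder r) ++ reverse (inorder l)    ≡⟨ reverse-++ (inorder l) (x ∷ inorder r) ⟨
  reverse (inorder l ++ x ∷ inorder r)              ∎
  where open ≡-Reasoning

apart-mirror : ∀ l r → Apart l r → Apart (mirror r) (mirror l)
apart-mirror ∅            ∅            _ = tt
apart-mirror ∅            (node _ _ _) _ = tt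
apart-mirror (node _ _ _) ∅            _ = tt
apart-mirror (node _ _ _) (node _ _ _) d = d ∘ sym

heap-mirror : ∀ {b t} → Heap b t → Heap b (mirror t)
heap-mirror ∅ = ∅
heap-mirror (node {l = l} {r} b<x hl hr l#r) =
  node b<x (heap-mirror hr) (heap-mirror hl) (apart-mirror l r l#r)

-- Canonical form: the sign of an inner node becomes an order of its subtrees

rootBelow : Tree → Tree → Bool
rootBelow ∅            _            = false
rootBelow (node _ _ _) ∅            = true
rootBelow (node x _ _) (node y _ _) = does (∣ x ∣ <? ∣ y ∣)

data Order : Tree → Tree → Set where
  empty   : Order ∅ ∅
  below   : ∀ {l r} → rootBelow l r ≡ true → rootBelow r l ≡ false → Order l r
  above   : ∀ {l r} → rootBelow r l ≡ true → rootBelow l r ≡ false → Order l r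

order : ∀ l r → Apart l r → Order l r
order ∅            ∅            _ = empty
order ∅            (node _ _ _) _ = above refl refl
order (node _ _ _) ∅            _ = below refl refl
order (node x _ _) (node y _ _) x≢y with ∣ x ∣ <? ∣ y ∣
... | yes x<y = below (dec-true (∣ x ∣ <? ∣ y ∣) x<y) (dec-false (∣ y ∣ <? ∣ x ∣) (<⇒≯ x<y))
... | no  x≮y = above (dec-true (∣ y ∣ <? ∣ x ∣) (≤∧≢⇒< (≮⇒≥ x≮y) (x≢y ∘ sym))) (dec-false (∣ x ∣ <? ∣ y ∣) x≮y)

-- Here `s` has the smaller root and `g` the greater. The label loses its sign because the order of
-- the subtrees now records it.
arrange : ℤ → Tree → Tree → Tree
arrange x s g = if isPos x then node (+ ∣ x ∣) g s else node (+ ∣ x ∣) s g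

branch : ℤ → Tree → Tree → Tree
branch x l r =
  if rootBelow l r then arrange x l r
  else if rootBelow r l then arrange x r l
  else node x ∅ ∅

canon : Tree → Tree
canon ∅            = ∅
canon (node x l r) = branch x (canon l) (canon r)

-- The pair stands in the order dictated by the sign of `x`. The constructor `positive` records two
-- comparisons because `orient` tests `rootBelow l r` first.
data Oriented (x : ℤ) (l r : Tree) : Set where
  negative : isPos x ≡ false → rootBelow l r ≡ true → Oriented x l r
  positive : isPos x ≡ true → rootBelow l r ≡ false → rootBelow r l ≡ true → Oriented x l r

data Branch (x : ℤ) (l r : Tree) : Tree → Set where
  leaf : l ≡ ∅ → r ≡ ∅ → Branch x l r (node x ∅ ∅)
  keep : Oriented x l r → Branch x l r (node (+ ∣ x ∣) l r)
  swap : Oriented x r l → Branch x l r (node (+ ∣ x ∣) r l)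

branch-view : ∀ x l r → Apart l r → Branch x l r (branch x l r)
branch-view x l r l#r with order l r l#r
... | empty = leaf refl refl
... | below l<r r≮l rewrite l<r with isPos x in eq
...   | true  = swap (positive eq r≮l l<r)
...   | false = keep (negative eq l<r)
branch-view x l r l#r | above r<l l≮r rewrite l≮r | r<l with isPos x in eq
...   | true  = keep (positive eq l≮r r<l)
...   | false = swap (negative eq r<l)

-- Either way `arrange` receives the smaller root first, so the original order is forgotten. This is
-- the source of flip invariance.
branch-comm : ∀ x l r → Apart l r → branch x l r ≡ branch x r l
branch-comm x l r l#r with order l r l#r
... | empty = refl
... | below l<r r≮l rewrite l<r | r≮l = refl
... | above r<l l≮r rewrite l≮r | r<l = refl

-- Canonical trees and flip equivalence

data SameRoot : Tree → Tree → Set where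
  ∅    : SameRoot ∅ ∅
  node : ∀ {x y l r l′ r′} → ∣ x ∣ ≡ ∣ y ∣ → SameRoot (node x l r) (node y l′ r′)

apart-resp : ∀ {l r l′ r′} → SameRoot l l′ → SameRoot r r′ → Apart l r → Apart l′ r′
apart-resp ∅        ∅        _ = tt
apart-resp ∅        (node _) _ = tt
apart-resp (node _) ∅        _ = tt
apart-resp (node p) (node q) d = λ e → d (trans p (trans e (sym q)))

apart-sym : ∀ l r → Apart l r → Apart r l
apart-sym ∅            ∅            _ = tt
apart-sym ∅            (node _ _ _) _ = tt
apart-sym (node _ _ _) ∅            _ = tt
apart-sym (node _ _ _) (node _ _ _) d = d ∘ sym

-- Both claims go together: `branch-view` needs the canonical subtrees to be apart, and they are
-- because their roots keep their absolute values.
canon-heap : ∀ {b t} → Heap b t → SameRoot t (canon t) × Heap b (canon t)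
canon-heap ∅ = ∅ , ∅
canon-heap (node {x = x} {l} {r} b<x hl hr l#r)
  with canon l | canon r | canon-heap hl | canon-heap hr
... | cl | cr | l~ , hcl | r~ , hcr with apart-resp l~ r~ l#r
... | cl#cr with branch x cl cr | branch-view x cl cr cl#cr
... | _ | leaf _ _ = node refl , node b<x ∅ ∅ tt
... | _ | keep _   = node refl , node b<x hcl hcr cl#cr
... | _ | swap _   = node refl , node b<x hcr hcl (apart-sym cl cr cl#cr)

canon-apart : ∀ {a b l r} → Heap a l → Heap b r → Apart l r → Apart (canon l) (canon r)
canon-apart hl hr = apart-resp (proj₁ (canon-heap hl)) (proj₁ (canon-heap hr))

canon-mirror : ∀ {b t} → Heap b t → canon (mirror t) ≡ canon t
canon-mirror ∅ = refl
canon-mirror (node {x = x} {l} {r} _ hl hr l#r)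
  rewrite canon-mirror hl | canon-mirror hr =
  sym (branch-comm x (canon l) (canon r) (canon-apart hl hr l#r))

-- Reversing a word mirrors its tree, and `branch` ignores the order of the subtrees at every node.
canon-reverse : ∀ {b} p → All (λ y → b < ∣ y ∣) p → Distinct p → canon (build (reverse p)) ≡ canon (build p)
canon-reverse p b<p d = begin
  canon (build (reverse p))                   ≡⟨ cong (canon ∘ build ∘ reverse) (inorder-build p) ⟨
  canon (build (reverse (inorder (build p)))) ≡⟨ cong (canon ∘ build) (inorder-mirror (build p)) ⟨
  canon (build (inorder (mirror (build p))))  ≡⟨ cong canon (build-inorder (heap-mirror h)) ⟩
  canon (mirror (build p))                    ≡⟨ canon-mirror h ⟩
  canon (build p)                             ∎
  where
  open ≡-Reasoning
  h = heap-build b<p d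

-- A flipped prefix whose letters all exceed x lies inside the left subtree of x, because the
-- insertions reach x along the left spine of the tree.
canon-reverse-prefix : ∀ {x p} → All (λ y → ∣ x ∣ < ∣ y ∣) p → Distinct p → ∀ t →
                       canon (inserts (reverse p) (insert x t)) ≡ canon (inserts p (insert x t))
canon-reverse-prefix {x} {p} x<p d = go
  where
  x<rev : All (λ y → ∣ x ∣ < ∣ y ∣) (reverse p)
  x<rev = Perm.All-resp-↭ (↭-sym (Perm.↭-reverse p)) x<p

  at : ∀ t → canon (inserts (reverse p) (node x ∅ t)) ≡ canon (inserts p (node x ∅ t))
  at t rewrite inserts-below x ∅ t x<p | inserts-below x ∅ t x<rev =
    cong (λ l → branch x l (canon t)) (canon-reverse p x<p d)

  go : ∀ t → canon (inserts (reverse p) (insert x t)) ≡ canon (inserts p (insert x t))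
  go ∅ = at ∅
  go (node y l r) with ∣ x ∣ <? ∣ y ∣
  ... | yes x<y rewrite insert-< {x} {y} {l} {r} x<y = at (node y l r)
  ... | no  x≮y
    rewrite insert-≮ {x} {y} {l} {r} x≮y
          | inserts-below y (insert x l) r (All.map (≤-<-trans (≮⇒≥ x≮y)) x<p)
          | inserts-below y (insert x l) r (All.map (≤-<-trans (≮⇒≥ x≮y)) x<rev) =
    cong (λ l′ → branch y l′ (canon r)) (go l)

-- Flips as prefix reversals

data Reversal : List ℤ → List ℤ → Set where
  whole  : ∀ σ → Reversal σ (reverse σ)
  prefix : ∀ p x σ → All (λ y → ∣ x ∣ < ∣ y ∣) p → Reversal (p ++ x ∷ σ) (reverse p ++ x ∷ σ)

reverse-take-all : ∀ (σ : List ℤ) → reverse (take (length σ) σ) ++ drop (length σ) σ ≡ reverse σ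
reverse-take-all σ rewrite take-all (length σ) σ ≤-refl | drop-all (length σ) σ ≤-refl = ++-identityʳ (reverse σ)

flip⇒reversal : ∀ {σ τ} → Flip σ τ → Reversal σ τ
flip⇒reversal {σ} (_ , _ , _ , inj₁ refl , refl) = subst (Reversal σ) (sym (reverse-take-all σ)) (whole σ)
flip⇒reversal {σ} (k , _ , _ , inj₂ (x , ρ , eq , x<p) , refl) =
  subst₂ Reversal (trans (cong (take k σ ++_) (sym eq)) (take++drop≡id k σ))
                  (cong (reverse (take k σ) ++_) (sym eq))
                  (prefix (take k σ) x ρ x<p)

flipEq-whole : ∀ σ → FlipEq σ (reverse σ)
flipEq-whole []        = ε
flipEq-whole σ@(_ ∷ _) = Eq.return (length σ , s≤s z≤n , ≤-refl , inj₁ refl , sym (reverse-take-all σ))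

flipEq-prefix : ∀ p x σ → All (λ y → ∣ x ∣ < ∣ y ∣) p → FlipEq (p ++ x ∷ σ) (reverse p ++ x ∷ σ)
flipEq-prefix []        x σ _   = ε
flipEq-prefix p@(_ ∷ _) x σ x<p = Eq.return
  ( length p , s≤s z≤n , subst (length p ≤_) (sym (length-++ p)) (m≤m+n (length p) _)
  , inj₂ (x , σ , drop-p , subst (All _) (sym take-p) x<p)
  , sym (cong₂ (λ a b → reverse a ++ b) take-p drop-p))
  where
  take-length : ∀ (q : List ℤ) {ys} → take (length q) (q ++ ys) ≡ q
  take-length []      = refl
  take-length (y ∷ q) = cong (y ∷_) (take-length q)
  drop-length : ∀ (q : List ℤ) {ys} → drop (length q) (q ++ ys) ≡ ys
  drop-length []      = refl
  drop-length (_ ∷ q) = drop-length q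
  take-p : take (length p) (p ++ x ∷ σ) ≡ p
  take-p = take-length p
  drop-p : drop (length p) (p ++ x ∷ σ) ≡ x ∷ σ
  drop-p = drop-length p

reversal⇒↭ : ∀ {σ τ} → Reversal σ τ → σ ↭ τ
reversal⇒↭ (whole σ)        = ↭-sym (Perm.↭-reverse σ)
reversal⇒↭ (prefix p x σ _) = Perm.++⁺ʳ (x ∷ σ) (↭-sym (Perm.↭-reverse p))

Letters : ℕ → List ℤ → Set
Letters b σ = All (λ x → b < ∣ x ∣) σ × Distinct σ

letters-resp : ∀ {b σ τ} → σ ↭ τ → Letters b σ → Letters b τ
letters-resp σ↭τ (b<σ , d) =
  Perm.All-resp-↭ σ↭τ b<σ ,
  PermSetoid.AllPairs-resp-↭ (setoid ℤ) (λ p → p ∘ sym) ((λ { refl p → p }) , (λ { refl p → p })) (↭⇒↭ₛ σ↭τ) d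

distinct-++ˡ : ∀ p {q} → Distinct (p ++ q) → Distinct p
distinct-++ˡ []      _       = []
distinct-++ˡ (x ∷ p) (d ∷ ds) = All.++⁻ˡ p d ∷ distinct-++ˡ p ds

reversal-canon : ∀ {σ τ} → Letters 0 σ → Reversal σ τ → canon (build τ) ≡ canon (build σ)
reversal-canon (0<σ , d) (whole σ) = canon-reverse σ 0<σ d
reversal-canon (_ , d)   (prefix p x σ x<p)
  rewrite foldr-++ insert ∅ (reverse p) (x ∷ σ) | foldr-++ insert ∅ p (x ∷ σ) =
  canon-reverse-prefix x<p (distinct-++ˡ p d) (build σ)

-- The canonical tree is an invariant of the flip class. Reversals merely permute letters, so
-- `Letters` travels along the chain in both directions.
flipEq-canon : ∀ {σ τ} → Letters 0 σ → FlipEq σ τ → canon (build σ) ≡ canon (build τ)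
flipEq-canon _ ε = refl
flipEq-canon h (fwd s ◅ ss) with flip⇒reversal s
... | r = trans (sym (reversal-canon h r)) (flipEq-canon (letters-resp (reversal⇒↭ r) h) ss)
flipEq-canon h (bwd s ◅ ss) with flip⇒reversal s
... | r = trans (reversal-canon h′ r) (flipEq-canon h′ ss)
  where h′ = letters-resp (↭-sym (reversal⇒↭ r)) h

-- Reversing all of `σ` becomes a prefix reversal guarded by `x`; a proper prefix keeps its own
-- guard.
reversal-congˡ : ∀ {σ τ x} ρ → All (λ y → ∣ x ∣ < ∣ y ∣) σ → Reversal σ τ → FlipEq (σ ++ x ∷ ρ) (τ ++ x ∷ ρ)
reversal-congˡ ρ x<σ (whole σ) = flipEq-prefix σ _ ρ x<σ
reversal-congˡ {x = x} ρ x<σ (prefix p y σ y<p)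
  rewrite ++-assoc p (y ∷ σ) (x ∷ ρ) | ++-assoc (reverse p) (y ∷ σ) (x ∷ ρ) = flipEq-prefix p y _ y<p

flipEq-congˡ : ∀ {σ τ x} ρ → All (λ y → ∣ x ∣ < ∣ y ∣) σ → FlipEq σ τ → FlipEq (σ ++ x ∷ ρ) (τ ++ x ∷ ρ)
flipEq-congˡ ρ _ ε = ε
flipEq-congˡ ρ x<σ (fwd s ◅ ss) with flip⇒reversal s
... | r = reversal-congˡ ρ x<σ r ◅◅ flipEq-congˡ ρ (Perm.All-resp-↭ (reversal⇒↭ r) x<σ) ss
flipEq-congˡ ρ x<σ (bwd s ◅ ss) with flip⇒reversal s
... | r = Eq.symmetric Flip (reversal-congˡ ρ x<τ r) ◅◅ flipEq-congˡ ρ x<τ ss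
  where x<τ = Perm.All-resp-↭ (↭-sym (reversal⇒↭ r)) x<σ

-- Three flips: reverse `L` in front of `x`, reverse the whole word, then reverse the prefix
-- `reverse R`.
flipEq-swap : ∀ L x R → All (λ y → ∣ x ∣ < ∣ y ∣) L → All (λ y → ∣ x ∣ < ∣ y ∣) R →
              FlipEq (L ++ x ∷ R) (R ++ x ∷ L)
flipEq-swap L x R x<L x<R =
  flipEq-prefix L x R x<L ◅◅
  subst (FlipEq _) rev (flipEq-whole (reverse L ++ x ∷ R)) ◅◅
  subst (λ R′ → FlipEq (reverse R ++ x ∷ L) (R′ ++ x ∷ L)) (reverse-involutive R)
        (flipEq-prefix (reverse R) x L (Perm.All-resp-↭ (↭-sym (Perm.↭-reverse R)) x<R))
  where
  open ≡-Reasoning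
  rev : reverse (reverse L ++ x ∷ R) ≡ reverse R ++ x ∷ L
  rev = begin
    reverse (reverse L ++ x ∷ R)            ≡⟨ reverse-++ (reverse L) (x ∷ R) ⟩
    reverse (x ∷ R) ++ reverse (reverse L)  ≡⟨ cong₂ _++_ (unfold-reverse x R) (reverse-involutive L) ⟩
    (reverse R ++ [ x ]) ++ L               ≡⟨ ++-assoc (reverse R) [ x ] L ⟩
    reverse R ++ x ∷ L                      ∎

-- Flips act on prefixes, so the right factor is exchanged to the left, changed there, and exchanged
-- back.
flipEq-cong : ∀ {L L′ x R R′} → All (λ y → ∣ x ∣ < ∣ y ∣) L → All (λ y → ∣ x ∣ < ∣ y ∣) R →
              All (λ y → ∣ x ∣ < ∣ y ∣) L′ → All (λ y → ∣ x ∣ < ∣ y ∣) R′ →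
              FlipEq L L′ → FlipEq R R′ → FlipEq (L ++ x ∷ R) (L′ ++ x ∷ R′)
flipEq-cong {L} {L′} {x} {R} {R′} x<L x<R x<L′ x<R′ L~ R~ =
  flipEq-congˡ R x<L L~ ◅◅ flipEq-swap L′ x R x<L′ x<R ◅◅
  flipEq-congˡ L′ x<R R~ ◅◅ flipEq-swap R′ x L′ x<R′ x<L′

-- Recovering signs from the order of subtrees

orient : ℤ → Tree → Tree → ℤ
orient x l r =
  if rootBelow l r then - (+ ∣ x ∣)
  else if rootBelow r l then + ∣ x ∣
  else x

∣orient∣ : ∀ x l r → ∣ orient x l r ∣ ≡ ∣ x ∣
∣orient∣ x l r with rootBelow l r | rootBelow r l
... | true  | _     = ℤₚ.∣-i∣≡∣i∣ (+ ∣ x ∣)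
... | false | true  = refl
... | false | false = refl

-- The shape stays fixed and the sign of each inner node is read off its subtrees, while leaves keep
-- theirs. This inverts `canon` up to flips on one side and exactly on the trees satisfying
-- `NegLeaf` on the other.
restore : Tree → Tree
restore ∅            = ∅
restore (node x l r) = node (orient x l r) (restore l) (restore r)

restore-root : ∀ t → SameRoot t (restore t)
restore-root ∅            = ∅
restore-root (node x l r) = node (sym (∣orient∣ x l r))

restore-heap : ∀ {b t} → Heap b t → Heap b (restore t)
restore-heap ∅ = ∅
restore-heap {b} (node {x = x} {l} {r} b<x hl hr l#r) =
  node (subst (b <_) e b<x) (subst (λ c → Heap c _) e (restore-heap hl)) (subst (λ c → Heap c _) e (restore-heap hr))
       (apart-resp (restore-root l) (restore-root r) l#r)
  where e = sym (∣orient∣ x l r)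

restore-inorder : ∀ t → map ∣_∣ (inorder (restore t)) ≡ map ∣_∣ (inorder t)
restore-inorder ∅ = refl
restore-inorder (node x l r)
  rewrite map-++ ∣_∣ (inorder l) (x ∷ inorder r)
        | map-++ ∣_∣ (inorder (restore l)) (orient x l r ∷ inorder (restore r)) =
  cong₂ _++_ (restore-inorder l) (cong₂ _∷_ (∣orient∣ x l r) (restore-inorder r))

orient-oriented : ∀ {x l r} → Oriented x l r → orient (+ ∣ x ∣) l r ≡ x
orient-oriented {+ zero}     (negative _ l<r) rewrite l<r = refl
orient-oriented { -[1+ n ]}  (negative _ l<r) rewrite l<r = refl
orient-oriented {+ suc n}    (positive _ l≮r r<l) rewrite l≮r | r<l = refl

-- At an inner node the order chosen by `branch` encodes the sign, so `orient` returns `x` itself;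
-- if the subtrees were exchanged, `flipEq-swap` repairs the word. Hence words with equal canonical
-- trees are flip equivalent.
inorder-restore-canon : ∀ {b t} → Heap b t → FlipEq (inorder t) (inorder (restore (canon t)))
inorder-restore-canon ∅ = ε
inorder-restore-canon {b} (node {x = x} {l} {r} b<x hl hr l#r)
  with canon l | canon r | canon-heap hl | canon-heap hr | inorder-restore-canon hl | inorder-restore-canon hr
... | cl | cr | l~ , hcl | r~ , hcr | l≈ | r≈
  with branch x cl cr | branch-view x cl cr (apart-resp l~ r~ l#r)
inorder-restore-canon (node b<x ∅ ∅ _) | _ | _ | ∅ , _ | ∅ , _ | _ | _ | _ | leaf refl refl = ε
... | _ | keep o rewrite orient-oriented o =
  flipEq-cong (heap-all hl) (heap-all hr) (heap-all (restore-heap hcl)) (heap-all (restore-heap hcr)) l≈ r≈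
... | _ | swap o rewrite orient-oriented o =
  flipEq-cong (heap-all hl) (heap-all hr) (heap-all (restore-heap hcl)) (heap-all (restore-heap hcr)) l≈ r≈ ◅◅
  flipEq-swap _ x _ (heap-all (restore-heap hcl)) (heap-all (restore-heap hcr))

-- On heaps this describes the image of `canon`, by `canon-negLeaf` and `canon-restore`.
NegLeaf : Tree → Set
NegLeaf ∅            = ⊤
NegLeaf (node x l r) = (isNeg x ≡ false ⊎ (l ≡ ∅ × r ≡ ∅)) × NegLeaf l × NegLeaf r

canon-negLeaf : ∀ {b t} → Heap b t → NegLeaf (canon t)
canon-negLeaf ∅ = tt
canon-negLeaf (node {x = x} {l} {r} _ hl hr l#r)
  with canon l | canon r | canon-apart hl hr l#r | canon-negLeaf hl | canon-negLeaf hr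
... | cl | cr | cl#cr | nl | nr with branch x cl cr | branch-view x cl cr cl#cr
... | _ | leaf _ _ = inj₂ (refl , refl) , tt , tt
... | _ | keep _   = inj₁ refl , nl , nr
... | _ | swap _   = inj₁ refl , nr , nl

nonneg : ∀ x → isNeg x ≡ false → + ∣ x ∣ ≡ x
nonneg (+ n) _ = refl

nonpos : ∀ n → isPos (- (+ n)) ≡ false
nonpos zero    = refl
nonpos (suc n) = refl

-- The sign given by `orient` is the one for which `branch` keeps the present order; taking the
-- absolute value then returns the nonnegative inner label.
canon-restore : ∀ {b t} → Heap b t → NegLeaf t → canon (restore t) ≡ t
canon-restore ∅ _ = refl
canon-restore {b} (node {x = x} {l} {r} b<x hl hr l#r) (x≥0 , nl , nr)
  rewrite canon-restore hl nl | canon-restore hr nr with order l r l#r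
... | empty = refl
canon-restore (node {x = x} {l} {r} b<x hl hr l#r) (inj₂ (refl , refl) , nl , nr) | below () _
canon-restore (node {x = x} {l} {r} b<x hl hr l#r) (inj₂ (refl , refl) , nl , nr) | above () _
canon-restore (node {x = x} {l} {r} b<x hl hr l#r) (inj₁ x≥0 , nl , nr) | below l<r _
  rewrite l<r | nonpos ∣ x ∣ | ℤₚ.∣-i∣≡∣i∣ (+ ∣ x ∣) | nonneg x x≥0 = refl
-- The label is nonzero since its absolute value exceeds `b`, so `isPos` recognises it as positive.
canon-restore (node {x = + suc n} {l} {r} b<x hl hr l#r) (inj₁ x≥0 , nl , nr) | above r<l l≮r
  rewrite l≮r | r<l = refl

-- Canonical words and signed peaks

Compatible : ℤ → ℤ → Set
Compatible x y = (∣ x ∣ < ∣ y ∣ → isNeg x ≡ false) × (∣ y ∣ < ∣ x ∣ → isNeg y ≡ false)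

CompatibleHead : ℤ → List ℤ → Set
CompatibleHead x []      = ⊤
CompatibleHead x (y ∷ _) = Compatible x y

-- This says that every negative letter is a peak, stated on adjacent pairs; the boundary zeros add
-- no condition.
Canonical : List ℤ → Set
Canonical []       = ⊤
Canonical (x ∷ xs) = CompatibleHead x xs × Canonical xs

inorder-node : ∀ x l r → ∃[ y ] ∃[ ys ] inorder (node x l r) ≡ y ∷ ys
inorder-node x ∅            r = x , inorder r , refl
inorder-node x (node y a b) r with inorder-node y a b
... | z , zs , eq = z , zs ++ x ∷ inorder r , cong (_++ x ∷ inorder r) eq

compatibleHead-++ˡ : ∀ x ys {zs} → CompatibleHead x (ys ++ zs) → CompatibleHead x ys
compatibleHead-++ˡ x []      _ = tt
compatibleHead-++ˡ x (_ ∷ _) c = c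

compatibleHead-below : ∀ {x ys} → All (λ y → ∣ x ∣ < ∣ y ∣) ys → isNeg x ≡ false → CompatibleHead x ys
compatibleHead-below []        _   = tt
compatibleHead-below (x<y ∷ _) x≥0 = (λ _ → x≥0) , λ y<x → contradiction x<y (<⇒≯ y<x)

compatibleHead⇒nonneg : ∀ {x ys} → (∃[ z ] ∃[ zs ] ys ≡ z ∷ zs) → All (λ y → ∣ x ∣ < ∣ y ∣) ys →
                        CompatibleHead x ys → isNeg x ≡ false
compatibleHead⇒nonneg (_ , _ , refl) (x<z ∷ _) (c , _) = c x<z

-- The first letter of the word is the bottom of the left spine. If `x` exceeds it, `x` becomes a
-- leaf and that letter an inner node; otherwise `x` acquires a nonempty right subtree and is inner
-- itself. These are the two halves of `Compatible`.
insert-negLeaf : ∀ {b x t} → Heap b t → All (λ y → ∣ x ∣ ≢ ∣ y ∣) (inorder t) →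
                 CompatibleHead x (inorder t) → NegLeaf t → NegLeaf (insert x t)
insert-negLeaf ∅ _ _ _ = inj₂ (refl , refl) , tt , tt
insert-negLeaf {x = x} (node {x = y} {l} {r} b<y hl hr l#r) x∉ c (y≥0 , nl , nr) with ∣ x ∣ <? ∣ y ∣
... | yes x<y rewrite insert-< {x} {y} {l} {r} x<y = 
  inj₁ (compatibleHead⇒nonneg {x} (inorder-node y l r) (heap-all (node x<y hl hr l#r)) c) , tt , y≥0 , nl , nr
... | no  x≮y rewrite insert-≮ {x} {y} {l} {r} x≮y =
  inj₁ (nonnegRoot l y≥0 c (All.++⁻ʳ (inorder l) x∉)) ,
  insert-negLeaf hl (All.++⁻ˡ (inorder l) x∉) (compatibleHead-++ˡ x (inorder l) c) nl , nr
  where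
  nonnegRoot : ∀ l → isNeg y ≡ false ⊎ (l ≡ ∅ × r ≡ ∅) → CompatibleHead x (inorder l ++ y ∷ inorder r) →
               All (λ z → ∣ x ∣ ≢ ∣ z ∣) (y ∷ inorder r) → isNeg y ≡ false
  nonnegRoot _ (inj₁ y≥0) _ _ = y≥0
  nonnegRoot ∅ (inj₂ _) (_ , c) (x≢y ∷ _) = c (≤∧≢⇒< (≮⇒≥ x≮y) (x≢y ∘ sym))
  nonnegRoot (node _ _ _) (inj₂ (() , _)) _ _

negLeaf-insert : ∀ {b x t} → Heap b t → All (λ y → ∣ x ∣ ≢ ∣ y ∣) (inorder t) →
                 NegLeaf (insert x t) → NegLeaf t × CompatibleHead x (inorder t)
negLeaf-insert ∅ _ _ = tt , tt
negLeaf-insert {x = x} (node {x = y} {l} {r} b<y hl hr l#r) x∉ n with ∣ x ∣ <? ∣ y ∣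
negLeaf-insert {x = x} (node {x = y} {l} {r} b<y hl hr l#r) x∉ n
    | yes x<y rewrite insert-< {x} {y} {l} {r} x<y with n
... | inj₁ x≥0 , _ , nt = nt , compatibleHead-below (heap-all (node x<y hl hr l#r)) x≥0
negLeaf-insert {x = x} (node {x = y} {l} {r} b<y hl hr l#r) x∉ n
    | no x≮y rewrite insert-≮ {x} {y} {l} {r} x≮y
  with n | negLeaf-insert hl (All.++⁻ˡ (inorder l) x∉) (proj₁ (proj₂ n))
... | inj₂ (eq , _) , _ | _ = ⊥-elim (insert≢∅ x l eq)
  where
  insert≢∅ : ∀ x t → insert x t ≢ ∅
  insert≢∅ x (node y _ _) with ∣ x ∣ <? ∣ y ∣
  ... | yes x<y rewrite dec-true (∣ x ∣ <? ∣ y ∣) x<y = λ ()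
  ... | no x≮y rewrite dec-false (∣ x ∣ <? ∣ y ∣) x≮y = λ ()
... | inj₁ y≥0 , _ , nr | nl , c = (inj₁ y≥0 , nl , nr) , extend l c
  where
  extend : ∀ l → CompatibleHead x (inorder l) → CompatibleHead x (inorder l ++ y ∷ inorder r)
  extend ∅ _ = (λ x<y → contradiction x<y x≮y) , λ _ → y≥0
  extend (node z a b) c with inorder (node z a b) | inorder-node z a b
  ... | _ | _ , _ , refl = c

canonical⇒negLeaf : ∀ {b w} → Letters b w → Canonical w → NegLeaf (build w)
canonical⇒negLeaf {w = []}    _ _ = tt
canonical⇒negLeaf {w = x ∷ w} (_ ∷ b<w , x∉ ∷ d) (c , cs) =
  insert-negLeaf (heap-build b<w d) (subst (All _) eq x∉) (subst (CompatibleHead x) eq c)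
                 (canonical⇒negLeaf (b<w , d) cs)
  where eq = sym (inorder-build w)

negLeaf⇒canonical : ∀ {b w} → Letters b w → NegLeaf (build w) → Canonical w
negLeaf⇒canonical {w = []}    _ _ = tt
negLeaf⇒canonical {w = x ∷ w} (_ ∷ b<w , x∉ ∷ d) n
  with negLeaf-insert (heap-build b<w d) (subst (All _) (sym (inorder-build w)) x∉) n
... | nw , c = subst (CompatibleHead x) (inorder-build w) c , negLeaf⇒canonical (b<w , d) nw

canon-nonempty : ∀ {b x l r} → Heap b (node x l r) → canon (node x l r) ≢ ∅
canon-nonempty {x = x} {l} {r} h e with canon (node x l r) | proj₁ (canon-heap h)
canon-nonempty h () | _ | node _

canon-inorder : ∀ {b t} → Heap b t → map ∣_∣ (inorder (canon t)) ↭ map ∣_∣ (inorder t)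
canon-inorder ∅ = ↭-refl
canon-inorder (node {x = x} {l} {r} _ hl hr l#r)
  with canon l | canon r | canon-heap hl | canon-heap hr | canon-inorder hl | canon-inorder hr
... | cl | cr | l~ , _ | r~ , _ | l↭ | r↭
  with branch x cl cr | branch-view x cl cr (apart-resp l~ r~ l#r)
canon-inorder (node _ ∅ ∅ _) | _ | _ | ∅ , _ | ∅ , _ | _ | _ | _ | leaf refl refl = ↭-refl
... | _ | keep _
  rewrite map-++ ∣_∣ (inorder l) (x ∷ inorder r) | map-++ ∣_∣ (inorder cl) (+ ∣ x ∣ ∷ inorder cr) =
  Perm.++⁺ l↭ (↭-prep ∣ x ∣ r↭)
... | _ | swap _
  rewrite map-++ ∣_∣ (inorder l) (x ∷ inorder r) | map-++ ∣_∣ (inorder cr) (+ ∣ x ∣ ∷ inorder cl) =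
  ↭-trans (Perm.shift ∣ x ∣ (map ∣_∣ (inorder cr)) (map ∣_∣ (inorder cl)))
  (↭-trans (↭-prep ∣ x ∣ (↭-trans (Perm.++-comm (map ∣_∣ (inorder cr)) _) (Perm.++⁺ l↭ r↭)))
  (↭-sym (Perm.shift ∣ x ∣ (map ∣_∣ (inorder l)) (map ∣_∣ (inorder r)))))

negs : List ℤ → ℕ
negs []       = 0
negs (x ∷ xs) = (if isNeg x then 1 else 0) + negs xs

negs-++ : ∀ xs ys → negs (xs ++ ys) ≡ negs xs + negs ys
negs-++ []       ys = refl
negs-++ (x ∷ xs) ys = trans (cong (λ k → (if isNeg x then 1 else 0) + k) (negs-++ xs ys))
                            (sym (+-assoc (if isNeg x then 1 else 0) _ _))

lastAbs : ℕ → List ℤ → ℕ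
lastAbs p []       = p
lastAbs p (x ∷ xs) = lastAbs ∣ x ∣ xs

lastAbs-++ : ∀ p xs ys → lastAbs p (xs ++ ys) ≡ lastAbs (lastAbs p xs) ys
lastAbs-++ p []       ys = refl
lastAbs-++ p (x ∷ xs) ys = lastAbs-++ ∣ x ∣ xs ys

lastAbs-above : ∀ {b x xs} p → All (λ y → b < ∣ y ∣) (x ∷ xs) → b < lastAbs p (x ∷ xs)
lastAbs-above _ (b<x ∷ [])                   = b<x
lastAbs-above {x = x} {y ∷ _} _ (_ ∷ b<ys) = lastAbs-above {x = y} ∣ x ∣ b<ys

signedPeak : ℕ → ℤ → ℕ → ℕ
signedPeak p x q = if isNeg x ∧ does (p <? ∣ x ∣) ∧ does (q <? ∣ x ∣) then 1 else 0

signedPeak-peak : ∀ {p x q} → p < ∣ x ∣ → q < ∣ x ∣ → signedPeak p x q ≡ (if isNeg x then 1 else 0)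
signedPeak-peak {p} {x} {q} p<x q<x
  rewrite dec-true (p <? ∣ x ∣) p<x | dec-true (q <? ∣ x ∣) q<x | ∧-identityʳ (isNeg x) = refl

signedPeak-left : ∀ {p x q} → ∣ x ∣ < p → signedPeak p x q ≡ 0
signedPeak-left {p} {x} x<p rewrite dec-false (p <? ∣ x ∣) (<⇒≯ x<p) | ∧-zeroʳ (isNeg x) = refl

signedPeak-right : ∀ {p x q} → ∣ x ∣ < q → signedPeak p x q ≡ 0
signedPeak-right {p} {x} {q} x<q
  rewrite dec-false (q <? ∣ x ∣) (<⇒≯ x<q) | ∧-zeroʳ (does (p <? ∣ x ∣)) | ∧-zeroʳ (isNeg x) = refl

branch-negs : ∀ x l r → Apart l r → (l ≡ ∅ → r ≡ ∅ → isNeg x ≡ false) →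
              negs (inorder (branch x l r)) ≡ negs (inorder l) + negs (inorder r)
branch-negs x l r l#r x≥0 with branch x l r | branch-view x l r l#r
... | _ | leaf refl refl rewrite x≥0 refl refl = refl
... | _ | keep _ = negs-++ (inorder l) _
... | _ | swap _ = trans (negs-++ (inorder r) _) (+-comm (negs (inorder r)) _)

-- Both outer neighbours lie at or below `b`, hence below all labels. A nonempty subtree of `x`
-- gives it a larger neighbour on that side, so the peaks are the leaves, and the leaves are the
-- labels whose sign `canon` preserves.
spkFrom-canon : ∀ {b t p} rest → Heap b t → p ≤ b → nextAbs rest ≤ b →
  spkFrom p (inorder t ++ rest) ≡ negs (inorder (canon t)) + spkFrom (lastAbs p (inorder t)) rest
spkFrom-canon rest ∅ _ _ = refl
spkFrom-canon {b} {_} {p} rest (node {x = x} {l} {r} b<x hl hr l#r) p≤b q≤b = begin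
  spkFrom p ((inorder l ++ x ∷ inorder r) ++ rest)
    ≡⟨ cong (spkFrom p) (++-assoc (inorder l) (x ∷ inorder r) rest) ⟩
  spkFrom p (inorder l ++ x ∷ (inorder r ++ rest))
    -- The letter after the left subtree is `x`, whose absolute value is the heap bound there.
    ≡⟨ spkFrom-canon (x ∷ (inorder r ++ rest)) hl (<⇒≤ (≤-<-trans p≤b b<x)) ≤-refl ⟩
  negs (inorder (canon l)) + (peak + spkFrom ∣ x ∣ (inorder r ++ rest))
    ≡⟨ cong (λ k → negs (inorder (canon l)) + (peak + k)) (spkFrom-canon rest hr ≤-refl (<⇒≤ (≤-<-trans q≤b b<x))) ⟩
  negs (inorder (canon l)) + (peak + (negs (inorder (canon r)) + rs))
    ≡⟨ rearrange (negs (inorder (canon l))) peak (negs (inorder (canon r))) rs ⟩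
  negs (inorder (canon l)) + negs (inorder (canon r)) + peak + rs
    ≡⟨ cong (_+ rs) (count hl hr l#r) ⟩
  negs (inorder (branch x (canon l) (canon r))) + rs
    ≡⟨ cong (λ k → negs (inorder (branch x (canon l) (canon r))) + spkFrom k rest)
            (lastAbs-++ p (inorder l) (x ∷ inorder r)) ⟨
  negs (inorder (canon (node x l r))) + spkFrom (lastAbs p (inorder l ++ x ∷ inorder r)) rest ∎
  where
  open ≡-Reasoning
  open +-*-Solver using (solve; _:+_; _:=_)
  peak = signedPeak (lastAbs p (inorder l)) x (nextAbs (inorder r ++ rest))
  rs = spkFrom (lastAbs ∣ x ∣ (inorder r)) rest
  rearrange : ∀ a k c d → a + (k + (c + d)) ≡ a + c + k + d
  rearrange = solve 4 (λ a k c d → a :+ (k :+ (c :+ d)) := a :+ c :+ k :+ d) refl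

  internal : ∀ {l r} → Heap ∣ x ∣ l → Heap ∣ x ∣ r → Apart l r → ∀ {k} → k ≡ 0 →
    (canon l ≡ ∅ → canon r ≡ ∅ → isNeg x ≡ false) →
    negs (inorder (canon l)) + negs (inorder (canon r)) + k ≡ negs (inorder (branch x (canon l) (canon r)))
  internal hl hr l#r refl x≥0 =
    trans (+-identityʳ _) (sym (branch-negs x _ _ (canon-apart hl hr l#r) x≥0))

  count : ∀ {l r} → Heap ∣ x ∣ l → Heap ∣ x ∣ r → Apart l r →
    negs (inorder (canon l)) + negs (inorder (canon r))
      + signedPeak (lastAbs p (inorder l)) x (nextAbs (inorder r ++ rest))
    ≡ negs (inorder (branch x (canon l) (canon r)))
  count ∅ ∅ _ = trans (signedPeak-peak {x = x} (≤-<-trans p≤b b<x) (≤-<-trans q≤b b<x)) (sym (+-identityʳ _))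
  count hl@(node {x = y} {c} {d} _ _ _ _) hr l#r = internal hl hr l#r
    (signedPeak-left {x = x} left)
    (λ e → ⊥-elim (canon-nonempty hl e))
    where
    left : ∣ x ∣ < lastAbs p (inorder (node y c d))
    left with inorder (node y c d) | inorder-node y c d | heap-all hl
    ... | _ | _ , _ , refl | x<ys = lastAbs-above p x<ys
  count ∅ hr@(node {x = y} {c} {d} _ _ _ _) l#r = internal ∅ hr l#r
    (signedPeak-right {x = x} right)
    (λ _ e → ⊥-elim (canon-nonempty hr e))
    where
    right : ∣ x ∣ < nextAbs (inorder (node y c d) ++ rest)
    right with inorder (node y c d) | inorder-node y c d | heap-all hr
    ... | _ | _ , _ , refl | x<y ∷ _ = x<y

spk-canon : ∀ {t} → Heap 0 t → spk (inorder t) ≡ negs (inorder (canon t))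
spk-canon {t} h = begin
  spk (inorder t)                      ≡⟨ cong spk (++-identityʳ (inorder t)) ⟨
  spk (inorder t ++ [])                ≡⟨ spkFrom-canon [] h z≤n z≤n ⟩
  negs (inorder (canon t)) + 0         ≡⟨ +-identityʳ _ ⟩
  negs (inorder (canon t))             ∎
  where open ≡-Reasoning

-- Signed maximum

minAbsFrom : ℕ → List ℤ → ℕ
minAbsFrom = foldr (λ y m → ∣ y ∣ ⊓ m)

minAbsFrom-≤ : ∀ m xs → minAbsFrom m xs ≤ m
minAbsFrom-≤ m []       = ≤-refl
minAbsFrom-≤ m (y ∷ xs) = ≤-trans (m⊓n≤n ∣ y ∣ _) (minAbsFrom-≤ m xs)

minAbsFrom-≤-mid : ∀ m xs x ys → minAbsFrom m (xs ++ x ∷ ys) ≤ ∣ x ∣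
minAbsFrom-≤-mid m []       x ys = m⊓n≤m ∣ x ∣ _
minAbsFrom-≤-mid m (y ∷ xs) x ys = ≤-trans (m⊓n≤n ∣ y ∣ _) (minAbsFrom-≤-mid m xs x ys)

minAbsFrom-glb : ∀ {k m xs} → k ≤ m → All (λ y → k ≤ ∣ y ∣) xs → k ≤ minAbsFrom m xs
minAbsFrom-glb k≤m []           = k≤m
minAbsFrom-glb k≤m (k≤y ∷ k≤ys) = ⊓-glb k≤y (minAbsFrom-glb k≤m k≤ys)

minAbs-mid : ∀ {L x R} → All (λ y → ∣ x ∣ < ∣ y ∣) L → All (λ y → ∣ x ∣ < ∣ y ∣) R →
             minAbs (L ++ x ∷ R) ≡ ∣ x ∣
minAbs-mid {[]} {x} {R} [] x<R =
  ≤-antisym (minAbsFrom-≤ ∣ x ∣ R) (minAbsFrom-glb ≤-refl (All.map <⇒≤ x<R))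
minAbs-mid {y ∷ L} {x} {R} (x<y ∷ x<L) x<R =
  ≤-antisym (minAbsFrom-≤-mid ∣ y ∣ L x R)
            (minAbsFrom-glb (<⇒≤ x<y) (All.++⁺ (All.map <⇒≤ x<L) (≤-refl ∷ All.map <⇒≤ x<R)))

splitAt≡-mid : ∀ {L x R} → All (λ y → ∣ x ∣ < ∣ y ∣) L → splitAt≡ ∣ x ∣ (L ++ x ∷ R) ≡ just (L , x , R)
splitAt≡-mid {[]} {x} [] rewrite dec-true (∣ x ∣ ≟ ∣ x ∣) refl = refl
splitAt≡-mid {y ∷ L} {x} {R} (x<y ∷ x<L)
  rewrite dec-false (∣ y ∣ ≟ ∣ x ∣) (<⇒≢ x<y ∘ sym) | splitAt≡-mid {L} {x} {R} x<L = refl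

splitMin-mid : ∀ {L x R} → All (λ y → ∣ x ∣ < ∣ y ∣) L → All (λ y → ∣ x ∣ < ∣ y ∣) R →
               splitMin (L ++ x ∷ R) ≡ just (L , x , R)
splitMin-mid {L} {x} {R} x<L x<R rewrite minAbs-mid {L} {x} {R} x<L x<R = splitAt≡-mid x<L

minAbs-root : ∀ {b x l r} → Heap b (node x l r) → minAbs (inorder (node x l r)) ≡ ∣ x ∣
minAbs-root (node _ hl hr _) = minAbs-mid (heap-all hl) (heap-all hr)

-- The body of `smaxF` after the split, with the split as arguments so that a known one can be
-- substituted.
smaxStep : ℕ → List ℤ → ℤ → List ℤ → ℤ
smaxStep f []        x []        = x
smaxStep f []        x R@(_ ∷ _) = if isPos x then x else smaxF f R
smaxStep f L@(_ ∷ _) x []        = if isPos x then x else smaxF f L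
smaxStep f L@(_ ∷ _) x R@(_ ∷ _) =
  if isPos x
  then (if does (minAbs R <? minAbs L) then smaxF f L else smaxF f R)
  else (if does (minAbs L <? minAbs R) then smaxF f L else smaxF f R)

smaxF-step : ∀ f σ {L x R} → splitMin σ ≡ just (L , x , R) → smaxF (suc f) σ ≡ smaxStep f L x R
smaxF-step f σ {[]}    {x} {[]}    eq rewrite eq = refl
smaxF-step f σ {[]}    {x} {_ ∷ _} eq rewrite eq = refl
smaxF-step f σ {_ ∷ _} {x} {[]}    eq rewrite eq = refl
smaxF-step f σ {_ ∷ _} {x} {_ ∷ _} eq rewrite eq = refl

smaxStep-left : ∀ f {L x} → (∃[ y ] ∃[ ys ] L ≡ y ∷ ys) →
                smaxStep f L x [] ≡ (if isPos x then x else smaxF f L)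
smaxStep-left f (_ , _ , refl) = refl

smaxStep-right : ∀ f {R x} → (∃[ y ] ∃[ ys ] R ≡ y ∷ ys) →
                 smaxStep f [] x R ≡ (if isPos x then x else smaxF f R)
smaxStep-right f (_ , _ , refl) = refl

smaxStep-both : ∀ f {L x R} → (∃[ y ] ∃[ ys ] L ≡ y ∷ ys) → (∃[ y ] ∃[ ys ] R ≡ y ∷ ys) →
  smaxStep f L x R ≡
  (if isPos x
   then (if does (minAbs R <? minAbs L) then smaxF f L else smaxF f R)
   else (if does (minAbs L <? minAbs R) then smaxF f L else smaxF f R))
smaxStep-both f (_ , _ , refl) (_ , _ , refl) = refl

-- The default 0 agrees with `smaxF` on the empty word.
firstLetter : List ℤ → ℤ
firstLetter []      = + 0
firstLetter (x ∷ _) = x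

firstLetter-++ : ∀ {xs ys} → (∃[ z ] ∃[ zs ] xs ≡ z ∷ zs) → firstLetter (xs ++ ys) ≡ firstLetter xs
firstLetter-++ (_ , _ , refl) = refl

firstLetter-node : ∀ x y a b r → firstLetter (inorder (node x (node y a b) r)) ≡ firstLetter (inorder (node y a b))
firstLetter-node x y a b r = firstLetter-++ (inorder-node y a b)

-- A node's word begins in its first subtree, and the sign puts first the subtree that the signed
-- maximum enters. The numbers `m` and `n` stand for the roots before canonicalization, which `smax`
-- compares.
firstLetter-branch : ∀ x y a b z c d {m n} → m ≡ ∣ y ∣ → n ≡ ∣ z ∣ → m ≢ n →
  firstLetter (inorder (branch x (node y a b) (node z c d))) ≡
  (if isPos x
   then (if does (n <? m) then firstLetter (inorder (node y a b)) else firstLetter (inorder (node z c d)))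
   else (if does (m <? n) then firstLetter (inorder (node y a b)) else firstLetter (inorder (node z c d))))
firstLetter-branch x y a b z c d refl refl y≢z with order (node y a b) (node z c d) y≢z
... | below y<z z≮y rewrite y<z | z≮y with isPos x
...   | true  = firstLetter-node (+ ∣ x ∣) z c d (node y a b)
...   | false = firstLetter-node (+ ∣ x ∣) y a b (node z c d)
firstLetter-branch x y a b z c d refl refl y≢z | above z<y y≮z rewrite z<y | y≮z with isPos x
...   | true  = firstLetter-node (+ ∣ x ∣) y a b (node z c d)
...   | false = firstLetter-node (+ ∣ x ∣) z c d (node y a b)

positive-abs : ∀ {x} → isPos x ≡ true → + ∣ x ∣ ≡ x
positive-abs {+ suc _} _ = refl

-- If exactly one subtree is empty, it counts as the greater: a positive `x` has it first and is
-- itself the first letter, a negative `x` has the nonempty subtree first. Two nonempty subtrees are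
-- the case of `firstLetter-branch`.
smaxF-canon : ∀ f {b t} → Heap b t → length (inorder t) ≤ f → smaxF f (inorder t) ≡ firstLetter (inorder (canon t))
smaxF-canon zero    ∅ _ = refl
smaxF-canon (suc f) ∅ _ = refl
smaxF-canon zero {t = node x l r} (node _ _ _ _) le =
  contradiction (subst (_≤ 0) (trans (length-++ (inorder l)) (+-suc _ _)) le) λ ()
smaxF-canon (suc f) {t = node x l r} (node _ hl hr l#r) le =
  trans (smaxF-step f (inorder l ++ x ∷ inorder r) (splitMin-mid (heap-all hl) (heap-all hr)))
        (step hl hr l#r (smaxF-canon f hl l≤f) (smaxF-canon f hr r≤f))
  where
  l+r≤f : length (inorder l) + length (inorder r) ≤ f
  l+r≤f = ≤-pred (subst (_≤ suc f) (trans (length-++ (inorder l)) (+-suc _ _)) le)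
  l≤f = m+n≤o⇒m≤o (length (inorder l)) l+r≤f
  r≤f = m+n≤o⇒n≤o (length (inorder l)) l+r≤f

  step : ∀ {l r} → Heap ∣ x ∣ l → Heap ∣ x ∣ r → Apart l r →
         smaxF f (inorder l) ≡ firstLetter (inorder (canon l)) →
         smaxF f (inorder r) ≡ firstLetter (inorder (canon r)) →
         smaxStep f (inorder l) x (inorder r) ≡ firstLetter (inorder (branch x (canon l) (canon r)))
  step ∅ ∅ _ _ _ = refl
  step {r = node y c d} ∅ hr@(node _ _ _ _) _ _ ihr
    rewrite smaxStep-right f {x = x} (inorder-node y c d) | ihr
    with canon (node y c d) | proj₁ (canon-heap hr)
  ... | node z a b | node _ with isPos x in eq
  ...   | true  = sym (positive-abs eq)
  ...   | false = sym (firstLetter-node (+ ∣ x ∣) z a b ∅)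
  step {l = node y c d} hl@(node _ _ _ _) ∅ _ ihl _
    rewrite smaxStep-left f {x = x} (inorder-node y c d) | ihl
    with canon (node y c d) | proj₁ (canon-heap hl)
  ... | node z a b | node _ with isPos x in eq
  ...   | true  = sym (positive-abs eq)
  ...   | false = sym (firstLetter-node (+ ∣ x ∣) z a b ∅)
  step {l = node y c d} {node y′ c′ d′} hl@(node _ _ _ _) hr@(node _ _ _ _) y≢y′ ihl ihr
    rewrite smaxStep-both f {x = x} (inorder-node y c d) (inorder-node y′ c′ d′)
          | ihl | ihr | minAbs-root hl | minAbs-root hr
    with canon (node y c d) | proj₁ (canon-heap hl) | canon (node y′ c′ d′) | proj₁ (canon-heap hr)
  ... | node z a b | node y≡z | node z′ a′ b′ | node y′≡z′ =
    sym (firstLetter-branch x z a b z′ a′ b′ y≡z y′≡z′ y≢y′)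

smax-canon : ∀ {b t} → Heap b t → smax (inorder t) ≡ firstLetter (inorder (canon t))
smax-canon h = smaxF-canon _ h ≤-refl

-- Counting canonical words

overSplits : ∀ {A : Set} → (List ℕ → ℕ → List ℕ → List A) → List ℕ → List A
overSplits f []      = []
overSplits f (y ∷ B) = f [] y B ++ overSplits (λ A → f (y ∷ A)) B

-- The canonical words on the letters S₁ ++ x ∷ S₂ (shifted by one), listed in increasing order,
-- whose first letter is x with sign s; n counts the letters after the first.
words : ℕ → Sign → List ℕ → ℕ → List ℕ → List (List ℤ)
followers descents ascents : ℕ → List ℕ → List ℕ → List (List ℤ)
words zero    s      _  x _  = [ [ s ◃ suc x ] ]
words (suc n) Sign.+ S₁ x S₂ = map (+ suc x ∷_) (followers n S₁ S₂)
-- A negative first letter has to be a peak, so a smaller letter follows.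
words (suc n) Sign.- S₁ x S₂ = map (-[1+ x ] ∷_) (descents n S₁ S₂)
followers n S₁ S₂ = descents n S₁ S₂ ++ ascents n S₁ S₂
-- A letter below its left neighbour is not a peak, hence positive; one above it may have either
-- sign.
descents n S₁ S₂ = overSplits (λ A y B → words n Sign.+ A y (B ++ S₂)) S₁
ascents n S₁ S₂ =
  overSplits (λ A y B → words n Sign.+ (S₁ ++ A) y B ++ words n Sign.- (S₁ ++ A) y B) S₂

wordWeight : ℕ → List ℤ → Laurent
wordWeight n w = mono (+ suc n ℤ.- + (2 * negs w))

total : ℕ → List (List ℤ) → Laurent
total n ws e = sum (map (λ w → wordWeight n w e) ws)

total-++ : ∀ n vs ws e → total n (vs ++ ws) e ≡ total n vs e + total n ws e
total-++ n vs ws e =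
  trans (cong sum (map-++ (λ w → wordWeight n w e) vs ws)) (sum-++ (map (λ w → wordWeight n w e) vs) _)

total-↭ : ∀ n {vs ws} → vs ↭ ws → total n vs ≈L total n ws
total-↭ n p e = sum-↭ (Perm.map⁺ _ p)

i+j-j≡i : ∀ i j → i ℤ.+ j ℤ.- j ≡ i
i+j-j≡i = solve-∀

i-j+j≡i : ∀ i j → i ℤ.- j ℤ.+ j ≡ i
i-j+j≡i = solve-∀

mono-shift : ∀ {a b} c → a ≡ b ℤ.+ c → ∀ e → mono a e ≡ mono b (e ℤ.- c)
mono-shift {b = b} c refl e with e ℤ.≟ b ℤ.+ c
... | yes refl rewrite dec-true (b ℤ.+ c ℤ.- c ℤ.≟ b) (i+j-j≡i b c) = refl
... | no e≢ rewrite dec-false (e ℤ.- c ℤ.≟ b) (λ { refl → e≢ (sym (i-j+j≡i e c)) }) = refl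

-- A new letter adds 1 to the exponent and, if negative, also subtracts 2, so `c` will be 1 or -1.
total-cons : ∀ n x c → (∀ w → + suc (suc n) ℤ.- + (2 * negs (x ∷ w)) ≡ (+ suc n ℤ.- + (2 * negs w)) ℤ.+ c) →
             ∀ ws → total (suc n) (map (x ∷_) ws) ≈L (c ·L total n ws)
total-cons n x c shift ws e =
  cong sum (trans (sym (map-∘ ws)) (map-cong (λ w → mono-shift c (shift w) e) ws))

total-cons-+ : ∀ n x ws → total (suc n) (map (+ suc x ∷_) ws) ≈L ((+ 1) ·L total n ws)
total-cons-+ n x = total-cons n (+ suc x) (+ 1) (λ w → shift (+ suc n) (+ (2 * negs w)))
  where
  shift : ∀ a b → (+ 1 ℤ.+ a) ℤ.- b ≡ (a ℤ.- b) ℤ.+ + 1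
  shift = solve-∀

total-cons-- : ∀ n x ws → total (suc n) (map (-[1+ x ] ∷_) ws) ≈L ((ℤ.- (+ 1)) ·L total n ws)
total-cons-- n x = total-cons n -[1+ x ] (ℤ.- (+ 1)) λ w →
  trans (cong (λ k → + suc (suc n) ℤ.- + k) (*-suc 2 (negs w))) (shift (+ suc n) (+ (2 * negs w)))
  where
  shift : ∀ a b → (+ 1 ℤ.+ a) ℤ.- (+ 2 ℤ.+ b) ≡ (a ℤ.- b) ℤ.+ ℤ.- (+ 1)
  shift = solve-∀

-- Summed recurrences and the generating functions of words

Σ< : ℕ → (ℕ → ℕ) → ℕ
Σ< zero    f = 0
Σ< (suc n) f = f n + Σ< n f

Σ<-cong : ∀ n {f g} → (∀ i → f i ≡ g i) → Σ< n f ≡ Σ< n g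
Σ<-cong zero    f≗g = refl
Σ<-cong (suc n) f≗g = cong₂ _+_ (f≗g n) (Σ<-cong n f≗g)

Σ<-first : ∀ n f → Σ< (suc n) f ≡ Σ< n (f ∘ suc) + f 0
Σ<-first zero    f = +-identityʳ (f 0)
Σ<-first (suc n) f = trans (cong (λ k → f (suc n) + k) (Σ<-first n f)) (sym (+-assoc (f (suc n)) _ _))

Σ<-append : ∀ m n f → Σ< (m + n) f ≡ Σ< m (λ i → f (i + n)) + Σ< n f
Σ<-append zero    n f = refl
Σ<-append (suc m) n f = trans (cong (λ k → f (m + n) + k) (Σ<-append m n f)) (sym (+-assoc (f (m + n)) _ _))

Σ<-distrib-+ : ∀ n f g → Σ< n (λ i → f i + g i) ≡ Σ< n f + Σ< n g
Σ<-distrib-+ zero    f g = refl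
Σ<-distrib-+ (suc n) f g =
  trans (cong (λ k → f n + g n + k) (Σ<-distrib-+ n f g)) (interchange (f n) (g n) (Σ< n f) (Σ< n g))
  where
  open +-*-Solver using (solve; _:+_; _:=_)
  interchange : ∀ a b c d → a + b + (c + d) ≡ a + c + (b + d)
  interchange = solve 4 (λ a b c d → a :+ b :+ (c :+ d) := a :+ c :+ (b :+ d)) refl

-- Since c = q - d, the left side is V_{q+1,-(c+1)}: starting from V_{q+1,-(q+1)} = 0, the
-- recurrence has collected V_{q,i} for c < i ≤ q.
VNd-sum : ∀ {q} d c → d + c ≡ q → ∀ e → VNd q d e ≡ Σ< d (λ i → VP q (suc (i + c)) (e ℤ.- ℤ.- (+ 1)))
VNd-sum zero    c _    e = refl
VNd-sum {q} (suc d) c refl e = begin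
  VNd q d e + VP q (suc d + c ∸ d) e′
    ≡⟨ cong₂ _+_ (VNd-sum d (suc c) (+-suc d c) e) (cong (λ k → VP q k e′) last) ⟩
  Σ< d (λ i → VP q (suc (i + suc c)) e′) + VP q (suc c) e′
    ≡⟨ cong (_+ VP q (suc c) e′) (Σ<-cong d (λ i → cong (λ k → VP q (suc k) e′) (+-suc i c))) ⟩
  Σ< d (λ i → VP q (suc (suc i + c)) e′) + VP q (suc (0 + c)) e′
    ≡⟨ Σ<-first d (λ i → VP q (suc (i + c)) e′) ⟨
  Σ< (suc d) (λ i → VP q (suc (i + c)) e′) ∎
  where
  open ≡-Reasoning
  e′ = e ℤ.- ℤ.- (+ 1)
  last : suc d + c ∸ d ≡ suc c
  last = trans (cong (_∸ d) (sym (+-suc d c))) (m+n∸m≡n d (suc c))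

VN-sum : ∀ {n} m c → m + c ≡ suc n → ∀ e →
         VN (suc (suc n)) (suc c) e ≡ Σ< m (λ i → VP (suc n) (suc (i + c)) (e ℤ.- ℤ.- (+ 1)))
VN-sum {n} m c m+c≡n e = trans (cong (λ d → VNd (suc n) d e) d≡m) (VNd-sum m c m+c≡n e)
  where
  d≡m : suc n ∸ c ≡ m
  d≡m = trans (cong (_∸ c) (sym m+c≡n)) (m+n∸n≡m m c)

-- The start V_{n+2,1} = t² V_{n+2,-1} turns the factor t⁻¹ of the full sum in `VN-sum` into t; each
-- further step adds one term t V_{n+1,-i}.
VP-sum : ∀ n c e → VP (suc (suc n)) (suc c) e ≡
         Σ< (suc n) (λ i → VP (suc n) (suc i) (e ℤ.- + 1)) + Σ< c (λ i → VN (suc n) (suc i) (e ℤ.- + 1))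
VP-sum n zero e = begin
  VN (suc (suc n)) 1 (e ℤ.- + 2)
    ≡⟨ VN-sum (suc n) 0 (+-identityʳ (suc n)) (e ℤ.- + 2) ⟩
  Σ< (suc n) (λ i → VP (suc n) (suc (i + 0)) ((e ℤ.- + 2) ℤ.- ℤ.- (+ 1)))
    ≡⟨ Σ<-cong (suc n) (λ i → cong₂ (λ k → VP (suc n) (suc k)) (+-identityʳ i) (shift e)) ⟩
  Σ< (suc n) (λ i → VP (suc n) (suc i) (e ℤ.- + 1))
    ≡⟨ +-identityʳ _ ⟨
  Σ< (suc n) (λ i → VP (suc n) (suc i) (e ℤ.- + 1)) + 0 ∎
  where
  open ≡-Reasoning
  shift : ∀ e → (e ℤ.- + 2) ℤ.- ℤ.- (+ 1) ≡ e ℤ.- + 1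
  shift = solve-∀
VP-sum n (suc c) e =
  trans (cong (_+ VN (suc n) (suc c) (e ℤ.- + 1)) (VP-sum n c e))
  (trans (+-assoc ps _ _) (cong (λ k → ps + k) (+-comm _ (VN (suc n) (suc c) (e ℤ.- + 1)))))
  where ps = Σ< (suc n) (λ i → VP (suc n) (suc i) (e ℤ.- + 1))

-- As `y` runs through `S`, the number of later entries takes each value below `length S` once; this
-- turns a sum over letters into a sum over indices.
total-overSplits : ∀ n f g S e → (∀ A y B → S ≡ A ++ y ∷ B → total n (f A y B) e ≡ g (length B)) →
                   total n (overSplits f S) e ≡ Σ< (length S) g
total-overSplits n f g []      e h = refl
total-overSplits n f g (y ∷ B) e h =
  trans (total-++ n (f [] y B) _ e)
        (cong₂ _+_ (h [] y B refl)
                   (total-overSplits n (λ A → f (y ∷ A)) g B e (λ A z C eq → h (y ∷ A) z C (cong (y ∷_) eq))))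

length-splitˡ : ∀ A y B (S : List ℕ) {n} → length (A ++ y ∷ B) + length S ≡ suc n → length A + length (B ++ S) ≡ n
length-splitˡ A y B S eq = suc-injective (begin
  suc (length A + length (B ++ S))      ≡⟨ +-suc (length A) _ ⟨
  length A + length (y ∷ B ++ S)        ≡⟨ length-++ A ⟨
  length (A ++ y ∷ B ++ S)              ≡⟨ cong length (++-assoc A (y ∷ B) S) ⟨
  length ((A ++ y ∷ B) ++ S)            ≡⟨ length-++ (A ++ y ∷ B) ⟩
  length (A ++ y ∷ B) + length S        ≡⟨ eq ⟩
  suc _                                 ∎)
  where open ≡-Reasoning

length-splitʳ : ∀ (S : List ℕ) A y B {n} → length S + length (A ++ y ∷ B) ≡ suc n → length (S ++ A) + length B ≡ n
length-splitʳ S A y B eq = suc-injective (begin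
  suc (length (S ++ A) + length B)      ≡⟨ +-suc (length (S ++ A)) _ ⟨
  length (S ++ A) + length (y ∷ B)      ≡⟨ length-++ (S ++ A) ⟨
  length ((S ++ A) ++ y ∷ B)            ≡⟨ cong length (++-assoc S A (y ∷ B)) ⟩
  length (S ++ A ++ y ∷ B)              ≡⟨ length-++ S ⟩
  length S + length (A ++ y ∷ B)        ≡⟨ eq ⟩
  suc _                                 ∎)
  where open ≡-Reasoning

-- Only the rank of the first letter matters: the index is one more than the number of larger
-- letters. After `x` is removed, a descent leads to an index above `c` and an ascent to an index
-- from 1 to `c`. Both signs are treated at once because an ascent allows both.
total-words : ∀ n S₁ x S₂ → length S₁ + length S₂ ≡ n → ∀ e →
  total (suc n) (words n Sign.+ S₁ x S₂) e ≡ VP (suc n) (suc (length S₂)) e ×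
  total (suc n) (words n Sign.- S₁ x S₂) e ≡ VN (suc n) (suc (length S₂)) e
total-words zero []      x []      refl e = +-identityʳ _ , +-identityʳ _
total-words (suc n) S₁ x S₂ len e = plus , minus
  where
  open ≡-Reasoning
  m = length S₁
  c = length S₂
  p = λ e i → VP (suc n) (suc i) e
  q = λ e i → VN (suc n) (suc i) e

  total-descents : ∀ e → total (suc n) (descents n S₁ S₂) e ≡ Σ< m (λ i → p e (i + c))
  total-descents e = total-overSplits (suc n) _ (λ i → p e (i + c)) S₁ e λ A y B eq →
    trans (proj₁ (total-words n A y (B ++ S₂)
                    (length-splitˡ A y B S₂ (trans (cong (λ S → length S + c) (sym eq)) len)) e))
          (cong (p e) (length-++ B))

  total-ascents : ∀ e → total (suc n) (ascents n S₁ S₂) e ≡ Σ< c (λ i → p e i + q e i)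
  total-ascents e = total-overSplits (suc n) _ (λ i → p e i + q e i) S₂ e λ A y B eq →
    let ih = total-words n (S₁ ++ A) y B
               (length-splitʳ S₁ A y B (trans (cong (λ S → m + length S) (sym eq)) len)) e
    in trans (total-++ (suc n) (words n Sign.+ (S₁ ++ A) y B) _ e) (cong₂ _+_ (proj₁ ih) (proj₂ ih))

  plus : total (suc (suc n)) (words (suc n) Sign.+ S₁ x S₂) e ≡ VP (suc (suc n)) (suc c) e
  plus = begin
    total (suc (suc n)) (words (suc n) Sign.+ S₁ x S₂) e
      ≡⟨ total-cons-+ (suc n) x (followers n S₁ S₂) e ⟩
    total (suc n) (followers n S₁ S₂) e′
      ≡⟨ total-++ (suc n) (descents n S₁ S₂) _ e′ ⟩
    total (suc n) (descents n S₁ S₂) e′ + total (suc n) (ascents n S₁ S₂) e′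
      ≡⟨ cong₂ _+_ (total-descents e′) (total-ascents e′) ⟩
    Σ< m (λ i → p e′ (i + c)) + Σ< c (λ i → p e′ i + q e′ i)
      ≡⟨ cong (λ k → Σ< m (λ i → p e′ (i + c)) + k) (Σ<-distrib-+ c (p e′) (q e′)) ⟩
    Σ< m (λ i → p e′ (i + c)) + (Σ< c (p e′) + Σ< c (q e′))
      ≡⟨ +-assoc (Σ< m (λ i → p e′ (i + c))) _ _ ⟨
    Σ< m (λ i → p e′ (i + c)) + Σ< c (p e′) + Σ< c (q e′)
      -- Descents and positive ascents together exhaust the indices from 1 to `m + c`.
      ≡⟨ cong (_+ Σ< c (q e′)) (Σ<-append m c (p e′)) ⟨
    Σ< (m + c) (p e′) + Σ< c (q e′)
      ≡⟨ cong (λ k → Σ< k (p e′) + Σ< c (q e′)) len ⟩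
    Σ< (suc n) (p e′) + Σ< c (q e′)
      ≡⟨ VP-sum n c e ⟨
    VP (suc (suc n)) (suc c) e ∎
    where e′ = e ℤ.- + 1

  minus : total (suc (suc n)) (words (suc n) Sign.- S₁ x S₂) e ≡ VN (suc (suc n)) (suc c) e
  minus = trans (total-cons-- (suc n) x (descents n S₁ S₂) e)
          (trans (total-descents (e ℤ.- ℤ.- (+ 1))) (sym (VN-sum m c len e)))

-- Words and flip classes

∈-overSplits⁺ : ∀ {X : Set} (f : List ℕ → ℕ → List ℕ → List X) A {y B w} → w ∈ f A y B → w ∈ overSplits f (A ++ y ∷ B)
∈-overSplits⁺ f []      w∈ = ∈-++⁺ˡ w∈
∈-overSplits⁺ f (z ∷ A) {y} {B} w∈ = ∈-++⁺ʳ (f [] z (A ++ y ∷ B)) (∈-overSplits⁺ (λ A → f (z ∷ A)) A w∈)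

∈-overSplits⁻ : ∀ {X : Set} (f : List ℕ → ℕ → List ℕ → List X) S {w} → w ∈ overSplits f S →
                ∃[ A ] ∃[ y ] ∃[ B ] (S ≡ A ++ y ∷ B × w ∈ f A y B)
∈-overSplits⁻ f (y ∷ B) w∈ with ∈-++⁻ (f [] y B) w∈
... | inj₁ w∈f = [] , y , B , refl , w∈f
... | inj₂ w∈r with ∈-overSplits⁻ (λ A → f (y ∷ A)) B w∈r
...   | A , z , C , refl , w∈f = y ∷ A , z , C , refl , w∈f

Sorted : List ℕ → Set
Sorted = AllPairs _<_

sorted-mid : ∀ A {x B} → Sorted (A ++ x ∷ B) → Sorted (A ++ B) × All (_< x) A × All (x <_) B
sorted-mid []      (x<B ∷ s) = s , [] , x<B
sorted-mid (a ∷ A) (a< ∷ s) with sorted-mid A s | All.++⁻ A a<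
... | s′ , A<x , x<B | a<A , a<x ∷ a<B = All.++⁺ a<A a<B ∷ s′ , a<x ∷ A<x , x<B

record IsWord (S : List ℕ) (s : Sign) (x : ℕ) (w : List ℤ) : Set where
  constructor isWord
  field
    first     : firstLetter w ≡ s ◃ suc x
    letters   : map ∣_∣ w ↭ map suc S
    canonical : Canonical w

isNeg-◃ : ∀ s y → isNeg (s ◃ suc y) ≡ false → s ≡ Sign.+
isNeg-◃ Sign.+ y _ = refl

compatible-◃ : ∀ s x s′ y → (x < y → s ≡ Sign.+) → (y < x → s′ ≡ Sign.+) → Compatible (s ◃ suc x) (s′ ◃ suc y)
compatible-◃ s x s′ y x<y⇒ y<x⇒ rewrite ℤₚ.abs-◃ s (suc x) | ℤₚ.abs-◃ s′ (suc y) =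
  (λ { (s≤s x<y) → cong (λ s → isNeg (s ◃ suc x)) (x<y⇒ x<y) }) ,
  (λ { (s≤s y<x) → cong (λ s → isNeg (s ◃ suc y)) (y<x⇒ y<x) })

cons-isWord : ∀ {S₁ S₂} s x {y w} s′ → IsWord (S₁ ++ S₂) s′ y w → Compatible (s ◃ suc x) (s′ ◃ suc y) →
              IsWord (S₁ ++ x ∷ S₂) s x ((s ◃ suc x) ∷ w)
cons-isWord {S₁} {S₂} s x {y} {w} s′ (isWord f p c) compat = isWord refl perm (compatHead w f , c)
  where
  compatHead : ∀ w → firstLetter w ≡ s′ ◃ suc y → CompatibleHead (s ◃ suc x) w
  compatHead []      _    = tt
  compatHead (_ ∷ _) refl = compat
  perm : ∣ s ◃ suc x ∣ ∷ map ∣_∣ w ↭ map suc (S₁ ++ x ∷ S₂)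
  perm rewrite ℤₚ.abs-◃ s (suc x) =
    ↭-trans (↭-prep (suc x) p) (↭-sym (Perm.map⁺ suc (Perm.shift x S₁ S₂)))

∈-words⁻ : ∀ n s S₁ x S₂ → length S₁ + length S₂ ≡ n → Sorted (S₁ ++ x ∷ S₂) →
           ∀ {w} → w ∈ words n s S₁ x S₂ → IsWord (S₁ ++ x ∷ S₂) s x w
∈-descents⁻ : ∀ n s S₁ x S₂ → length S₁ + length S₂ ≡ suc n → Sorted (S₁ ++ x ∷ S₂) →
              ∀ {w} → w ∈ descents n S₁ S₂ → IsWord (S₁ ++ x ∷ S₂) s x ((s ◃ suc x) ∷ w)
∈-ascents⁻ : ∀ n S₁ x S₂ → length S₁ + length S₂ ≡ suc n → Sorted (S₁ ++ x ∷ S₂) →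
             ∀ {w} → w ∈ ascents n S₁ S₂ → IsWord (S₁ ++ x ∷ S₂) Sign.+ x (+ suc x ∷ w)

∈-words⁻ zero s [] x [] _ _ (here refl) = isWord refl (↭-reflexive (cong [_] (ℤₚ.abs-◃ s (suc x)))) (tt , tt)
∈-words⁻ (suc n) Sign.- S₁ x S₂ len sorted w∈ with ∈-map⁻ _ w∈
... | _ , v∈ , refl = ∈-descents⁻ n Sign.- S₁ x S₂ len sorted v∈
∈-words⁻ (suc n) Sign.+ S₁ x S₂ len sorted w∈ with ∈-map⁻ _ w∈
... | _ , v∈ , refl with ∈-++⁻ (descents n S₁ S₂) v∈
...   | inj₁ v∈d = ∈-descents⁻ n Sign.+ S₁ x S₂ len sorted v∈d
...   | inj₂ v∈a = ∈-ascents⁻ n S₁ x S₂ len sorted v∈a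

∈-descents⁻ n s S₁ x S₂ len sorted w∈ with ∈-overSplits⁻ _ S₁ w∈ | sorted-mid S₁ sorted
... | A , y , B , refl , w∈f | sorted′ , S₁<x , _ with All.++⁻ʳ A S₁<x
...   | y<x ∷ _ =
  cons-isWord {A ++ y ∷ B} {S₂} s x Sign.+
    (subst (λ S → IsWord S Sign.+ y _) (sym assoc)
      (∈-words⁻ n Sign.+ A y (B ++ S₂) (length-splitˡ A y B S₂ len) (subst Sorted assoc sorted′) w∈f))
    (compatible-◃ s x Sign.+ y (λ x<y → contradiction x<y (<⇒≯ y<x)) (λ _ → refl))
  where assoc = ++-assoc A (y ∷ B) S₂

∈-ascents⁻ n S₁ x S₂ len sorted w∈ with ∈-overSplits⁻ _ S₂ w∈ | sorted-mid S₁ sorted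
... | A , y , B , refl , w∈f | sorted′ , _ , x<S₂ with All.++⁻ʳ A x<S₂
...   | x<y ∷ _ = go (∈-++⁻ (words n Sign.+ (S₁ ++ A) y B) w∈f)
  where
  assoc = ++-assoc S₁ A (y ∷ B)
  cons : ∀ s {w} → w ∈ words n s (S₁ ++ A) y B → IsWord (S₁ ++ x ∷ A ++ y ∷ B) Sign.+ x (+ suc x ∷ w)
  cons s v∈ = cons-isWord {S₁} {A ++ y ∷ B} Sign.+ x s
    (subst (λ S → IsWord S s y _) assoc
      (∈-words⁻ n s (S₁ ++ A) y B (length-splitʳ S₁ A y B len) (subst Sorted (sym assoc) sorted′) v∈))
    (compatible-◃ Sign.+ x s y (λ _ → refl) (λ y<x → contradiction y<x (<⇒≯ x<y)))
  go : ∀ {w} → w ∈ words n Sign.+ (S₁ ++ A) y B ⊎ w ∈ words n Sign.- (S₁ ++ A) y B →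
       IsWord (S₁ ++ x ∷ A ++ y ∷ B) Sign.+ x (+ suc x ∷ w)
  go (inj₁ v∈) = cons Sign.+ v∈
  go (inj₂ v∈) = cons Sign.- v∈

∣-∣≡suc : ∀ i {y} → ∣ i ∣ ≡ suc y → ∃[ s ] i ≡ s ◃ suc y
∣-∣≡suc (+ _)    refl = Sign.+ , refl
∣-∣≡suc -[1+ _ ] refl = Sign.- , refl

-- Of the first two letters the smaller is not negative. A smaller second letter is thus positive
-- and the tail is in `descents`; a larger one forces `s` to be positive and puts the tail in
-- `ascents`.
∈-words⁺ : ∀ n s S₁ x S₂ → length S₁ + length S₂ ≡ n → Sorted (S₁ ++ x ∷ S₂) →
           ∀ {w} → IsWord (S₁ ++ x ∷ S₂) s x w → w ∈ words n s S₁ x S₂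
∈-words⁺ _ Sign.+ _ _ _ _ _ {[]} (isWord () _ _)
∈-words⁺ _ Sign.- _ _ _ _ _ {[]} (isWord () _ _)
∈-words⁺ zero s [] x [] _ _ {_ ∷ []} (isWord refl _ _) = here refl
∈-words⁺ zero s [] x [] _ _ {_ ∷ _ ∷ _} (isWord refl p _) = contradiction (Perm.↭-length p) λ ()
∈-words⁺ (suc n) s S₁ x S₂ len sorted {_ ∷ w} (isWord refl p (c , cs)) = go w p′ c cs
  where
  p′ : map ∣_∣ w ↭ map suc (S₁ ++ S₂)
  p′ = ↭-trans (Perm.drop-mid [] (map suc S₁)
         (subst₂ (λ k T → k ∷ map ∣_∣ w ↭ T) (ℤₚ.abs-◃ s (suc x)) (map-++ suc S₁ (x ∷ S₂)) p))
         (↭-reflexive (sym (map-++ suc S₁ S₂)))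
  sorted′ = proj₁ (sorted-mid S₁ sorted)

  follow : ∀ {w} → w ∈ descents n S₁ S₂ ⊎ (s ≡ Sign.+ × w ∈ ascents n S₁ S₂) → (s ◃ suc x) ∷ w ∈ words (suc n) s S₁ x S₂
  follow = followAt s
    where
    followAt : ∀ s {w} → w ∈ descents n S₁ S₂ ⊎ (s ≡ Sign.+ × w ∈ ascents n S₁ S₂) →
               (s ◃ suc x) ∷ w ∈ words (suc n) s S₁ x S₂
    followAt Sign.+ (inj₁ d)       = ∈-map⁺ _ (∈-++⁺ˡ d)
    followAt Sign.+ (inj₂ (_ , a)) = ∈-map⁺ _ (∈-++⁺ʳ (descents n S₁ S₂) a)
    followAt Sign.- (inj₁ d)       = ∈-map⁺ _ d

  go : ∀ w → map ∣_∣ w ↭ map suc (S₁ ++ S₂) → CompatibleHead (s ◃ suc x) w → Canonical w →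
       (s ◃ suc x) ∷ w ∈ words (suc n) s S₁ x S₂
  go [] p _ _ = contradiction (trans (Perm.↭-length p) (trans (length-map suc (S₁ ++ S₂)) (trans (length-++ S₁) len))) λ ()
  go (z ∷ w) p c cs with ∈-map⁻ suc (Perm.∈-resp-↭ p (here refl))
  ... | y , y∈ , ∣z∣≡ with ∣-∣≡suc z ∣z∣≡
  ... | s′ , refl with ∈-++⁻ S₁ y∈
  ... | inj₁ y∈S₁ with ∈-∃++ y∈S₁
  ...   | A , B , refl = follow (inj₁ (∈-overSplits⁺ _ A (∈-words⁺ n Sign.+ A y (B ++ S₂) (length-splitˡ A y B S₂ len)
                           (subst Sorted assoc sorted′)
                           (isWord (cong (_◃ suc y) s′≡+) (subst (λ S → _ ↭ map suc S) assoc p) cs))))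
    where
    assoc = ++-assoc A (y ∷ B) S₂
    y<x : y < x
    y<x with All.++⁻ʳ A (proj₁ (proj₂ (sorted-mid S₁ sorted)))
    ... | y<x ∷ _ = y<x
    s′≡+ : s′ ≡ Sign.+
    s′≡+ = isNeg-◃ s′ y (proj₂ c (subst₂ _<_ (sym (ℤₚ.abs-◃ s′ (suc y))) (sym (ℤₚ.abs-◃ s (suc x))) (s≤s y<x)))
  go (z ∷ w) p c cs | y , y∈ , ∣z∣≡ | s′ , refl | inj₂ y∈S₂ with ∈-∃++ y∈S₂
  ...   | A , B , refl = follow (inj₂ (s≡+ , ∈-overSplits⁺ _ A (either s′ (∈-words⁺ n s′ (S₁ ++ A) y B
                           (length-splitʳ S₁ A y B len)
                           (subst Sorted (sym assoc) sorted′)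
                           (isWord refl (subst (λ S → _ ↭ map suc S) (sym assoc) p) cs)))))
    where
    assoc = ++-assoc S₁ A (y ∷ B)
    x<y : x < y
    x<y with All.++⁻ʳ A (proj₂ (proj₂ (sorted-mid S₁ sorted)))
    ... | x<y ∷ _ = x<y
    s≡+ : s ≡ Sign.+
    s≡+ = isNeg-◃ s x (proj₁ c (subst₂ _<_ (sym (ℤₚ.abs-◃ s (suc x))) (sym (ℤₚ.abs-◃ s′ (suc y))) (s≤s x<y)))
    either : ∀ s {w} → w ∈ words n s (S₁ ++ A) y B → w ∈ words n Sign.+ (S₁ ++ A) y B ++ words n Sign.- (S₁ ++ A) y B
    either Sign.+ = ∈-++⁺ˡ
    either Sign.- = ∈-++⁺ʳ (words n Sign.+ (S₁ ++ A) y B)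

firstAbs∈ : List ℕ → List ℤ → Set
firstAbs∈ S w = ∣ firstLetter w ∣ ∈ map suc S

words-first : ∀ n s S₁ x S₂ → All (λ w → firstLetter w ≡ s ◃ suc x) (words n s S₁ x S₂)
words-first zero    s      _  x _ = refl ∷ []
words-first (suc n) Sign.+ _  x _ = All.map⁺ (All.universal (λ _ → refl) _)
words-first (suc n) Sign.- _  x _ = All.map⁺ (All.universal (λ _ → refl) _)

words-firstAbs : ∀ n s S₁ x S₂ → All (λ w → ∣ firstLetter w ∣ ≡ suc x) (words n s S₁ x S₂)
words-firstAbs n s S₁ x S₂ = All.map (λ e → trans (cong ∣_∣ e) (ℤₚ.abs-◃ s (suc x))) (words-first n s S₁ x S₂)

-- Words from different choices of `y` differ in the absolute value of their first letter. The
-- second conclusion is carried along to make this disjointness provable.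
overSplits-unique : ∀ f S → Unique S →
  (∀ A y B → S ≡ A ++ y ∷ B → Unique (f A y B)) →
  (∀ A y B → All (λ w → ∣ firstLetter w ∣ ≡ suc y) (f A y B)) →
  Unique (overSplits f S) × All (firstAbs∈ S) (overSplits f S)
overSplits-unique f []      _        u h = [] , []
overSplits-unique f (y ∷ B) (y∉B ∷ uB) u h
  with overSplits-unique (λ A → f (y ∷ A)) B uB (λ A z C eq → u (y ∷ A) z C (cong (y ∷_) eq)) (λ A → h (y ∷ A))
... | ur , hr =
  Unique.++⁺ (u [] y B refl) ur disjoint ,
  All.++⁺ (All.map here (h [] y B)) (All.map there hr)
  where
  disjoint : ∀ {w} → ¬ (w ∈ f [] y B × w ∈ overSplits (λ A → f (y ∷ A)) B)
  disjoint (w∈f , w∈r) with ∈-map⁻ suc (subst (_∈ map suc B) (All.lookup (h [] y B) w∈f) (All.lookup hr w∈r))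
  ... | _ , z∈B , refl = All.lookup y∉B z∈B refl

sorted⇒unique : ∀ {S} → Sorted S → Unique S
sorted⇒unique = AllPairs.map <⇒≢

sorted-++ : ∀ A {B} → Sorted (A ++ B) → Sorted A × Sorted B × All (λ a → All (a <_) B) A
sorted-++ []      s        = [] , s , []
sorted-++ (a ∷ A) (a< ∷ s) with sorted-++ A s
... | sA , sB , A<B = All.++⁻ˡ A a< ∷ sA , sB , All.++⁻ʳ A a< ∷ A<B

words-unique : ∀ n s S₁ x S₂ → Sorted (S₁ ++ x ∷ S₂) → Unique (words n s S₁ x S₂)
descents-unique : ∀ n S₁ S₂ → Sorted (S₁ ++ S₂) → Unique (descents n S₁ S₂) × All (firstAbs∈ S₁) (descents n S₁ S₂)
ascents-unique : ∀ n S₁ S₂ → Sorted (S₁ ++ S₂) → Unique (ascents n S₁ S₂) × All (firstAbs∈ S₂) (ascents n S₁ S₂)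

words-unique zero    _      _  x _  _ = [] ∷ []
words-unique (suc n) Sign.- S₁ x S₂ sorted =
  Unique.map⁺ ∷-injectiveʳ (proj₁ (descents-unique n S₁ S₂ (proj₁ (sorted-mid S₁ sorted))))
words-unique (suc n) Sign.+ S₁ x S₂ sorted = Unique.map⁺ ∷-injectiveʳ (Unique.++⁺ ud ua disjoint)
  where
  sorted′ = proj₁ (sorted-mid S₁ sorted)
  ud = proj₁ (descents-unique n S₁ S₂ sorted′)
  ua = proj₁ (ascents-unique n S₁ S₂ sorted′)
  disjoint : ∀ {w} → ¬ (w ∈ descents n S₁ S₂ × w ∈ ascents n S₁ S₂)
  disjoint (w∈d , w∈a)
    with ∈-map⁻ suc (All.lookup (proj₂ (descents-unique n S₁ S₂ sorted′)) w∈d)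
       | ∈-map⁻ suc (All.lookup (proj₂ (ascents-unique n S₁ S₂ sorted′)) w∈a)
  ... | y , y∈ , e | z , z∈ , e′ =
    <-irrefl (suc-injective (trans (sym e) e′))
             (All.lookup (All.lookup (proj₂ (proj₂ (sorted-++ S₁ sorted′))) y∈) z∈)

descents-unique n S₁ S₂ sorted = overSplits-unique _ S₁ (sorted⇒unique (proj₁ (sorted-++ S₁ sorted)))
  (λ { A y B refl → words-unique n Sign.+ A y (B ++ S₂) (subst Sorted (++-assoc A (y ∷ B) S₂) sorted) })
  (λ A y B → words-firstAbs n Sign.+ A y (B ++ S₂))

ascents-unique n S₁ S₂ sorted = overSplits-unique _ S₂ (sorted⇒unique (proj₁ (proj₂ (sorted-++ S₁ sorted))))
  (λ { A y B refl →
    let sorted′ = subst Sorted (sym (++-assoc S₁ A (y ∷ B))) sorted in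
    Unique.++⁺ (words-unique n Sign.+ (S₁ ++ A) y B sorted′) (words-unique n Sign.- (S₁ ++ A) y B sorted′)
      λ (w∈+ , w∈-) → signs≢ (trans (sym (All.lookup (words-first n Sign.+ (S₁ ++ A) y B) w∈+))
                                     (All.lookup (words-first n Sign.- (S₁ ++ A) y B) w∈-)) })
  (λ A y B → All.++⁺ (words-firstAbs n Sign.+ (S₁ ++ A) y B) (words-firstAbs n Sign.- (S₁ ++ A) y B))
  where
  signs≢ : ∀ {y} → + suc y ≢ -[1+ y ]
  signs≢ ()

-- The canonical word as a complete invariant of flip classes

canonicalWord : List ℤ → List ℤ
canonicalWord σ = inorder (canon (build σ))

signedPerm⇒letters : ∀ {n σ} → SignedPerm n σ → Letters 0 σ
signedPerm⇒letters {n} p =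
  All.map⁻ {P = 0 <_} (Perm.All-resp-↭ (↭-sym p) (All.map⁺ (All.universal (λ _ → s≤s z≤n) (upTo n)))) ,
  AllPairs.map⁻ (PermSetoid.Unique-resp-↭ (setoid ℕ) (↭⇒↭ₛ (↭-sym p)) (Unique.map⁺ suc-injective (Unique.upTo⁺ n)))

signedPerm⇒heap : ∀ {n σ} → SignedPerm n σ → Heap 0 (build σ)
signedPerm⇒heap p with signedPerm⇒letters p
... | 0<σ , d = heap-build 0<σ d

canonicalWord-smax : ∀ {n σ} → SignedPerm n σ → smax σ ≡ firstLetter (canonicalWord σ)
canonicalWord-smax {σ = σ} p = trans (cong smax (sym (inorder-build σ))) (smax-canon (signedPerm⇒heap p))

canonicalWord-spk : ∀ {n σ} → SignedPerm n σ → spk σ ≡ negs (canonicalWord σ)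
canonicalWord-spk {σ = σ} p = trans (cong spk (sym (inorder-build σ))) (spk-canon (signedPerm⇒heap p))

canonicalWord-letters : ∀ {n σ} → SignedPerm n σ → SignedPerm n (canonicalWord σ)
canonicalWord-letters {n} {σ} p =
  ↭-trans (canon-inorder (signedPerm⇒heap p)) (subst (SignedPerm n) (sym (inorder-build σ)) p)

canonicalWord-canonical : ∀ {n σ} → SignedPerm n σ → Canonical (canonicalWord σ)
canonicalWord-canonical {n} {σ} p = negLeaf⇒canonical (signedPerm⇒letters (canonicalWord-letters {σ = σ} p))
  (subst NegLeaf (sym (build-inorder (proj₂ (canon-heap h)))) (canon-negLeaf h))
  where h = signedPerm⇒heap p

-- Equal canonical words have equal canonical trees, and the word restored from this tree is flip
-- equivalent to both permutations.
canonicalWord-complete : ∀ {n σ τ} → SignedPerm n σ → SignedPerm n τ → canonicalWord σ ≡ canonicalWord τ → FlipEq σ τ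
canonicalWord-complete {n} {σ} {τ} p q eq =
  subst (FlipEq σ) (cong (inorder ∘ restore) canon≡) (back p) ◅◅ Eq.symmetric Flip (back q)
  where
  back : ∀ {σ} → SignedPerm n σ → FlipEq σ (inorder (restore (canon (build σ))))
  back {σ} p = subst (λ ρ → FlipEq ρ (inorder (restore (canon (build σ))))) (inorder-build σ)
                     (inorder-restore-canon (signedPerm⇒heap p))
  canon≡ : canon (build σ) ≡ canon (build τ)
  canon≡ = trans (sym (build-inorder (proj₂ (canon-heap (signedPerm⇒heap p)))))
           (trans (cong build eq) (build-inorder (proj₂ (canon-heap (signedPerm⇒heap q)))))

canonicalWord-flipEq : ∀ {n σ τ} → SignedPerm n σ → FlipEq σ τ → canonicalWord σ ≡ canonicalWord τ
canonicalWord-flipEq p σ~τ = cong inorder (flipEq-canon (signedPerm⇒letters p) σ~τ)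

-- In general `w` is not its own preimage: `restore` must first translate the order of subtrees in
-- its tree into signs.
canonicalWord-surjective : ∀ {n w} → SignedPerm n w → Canonical w → ∃[ σ ] (SignedPerm n σ × canonicalWord σ ≡ w)
canonicalWord-surjective {n} {w} p c = inorder (restore t) , perm , eq
  where
  t = build w
  h = signedPerm⇒heap p
  perm : SignedPerm n (inorder (restore t))
  perm = ↭-trans (↭-reflexive (trans (restore-inorder t) (cong (map ∣_∣) (inorder-build w)))) p
  eq : canonicalWord (inorder (restore t)) ≡ w
  eq = trans (cong (inorder ∘ canon) (build-inorder (restore-heap h)))
       (trans (cong inorder (canon-restore h (canonical⇒negLeaf (signedPerm⇒letters p) c))) (inorder-build w))

allPairs-map : ∀ {X : Set} {P : X → Set} {R Q : X → X → Set} → (∀ {x y} → P x → P y → R x y → Q x y) →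
               ∀ {xs} → All P xs → AllPairs R xs → AllPairs Q xs
allPairs-map f []         []         = []
allPairs-map f (px ∷ pxs) (rx ∷ rxs) =
  All.map (λ (py , r) → f px py r) (All.zip (pxs , rx)) ∷ allPairs-map f pxs rxs

classSum-total : ∀ n {F} → All (SignedPerm n) F →
                 foldr (λ σ acc → weight n σ +L acc) 0L F ≈L total n (map canonicalWord F)
classSum-total n []       e = refl
classSum-total n {σ ∷ F} (p ∷ ps) e =
  cong₂ _+_ (cong (λ k → mono (+ suc n ℤ.- + (2 * k)) e) (canonicalWord-spk {σ = σ} p)) (classSum-total n ps e)

applyUpTo-split : ∀ (f : ℕ → ℕ) n y → y < n → ∃[ A ] ∃[ B ] (applyUpTo f n ≡ A ++ f y ∷ B × length A ≡ y)
applyUpTo-split f (suc n) zero    _         = [] , _ , refl , refl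
applyUpTo-split f (suc n) (suc y) (s≤s y<n) with applyUpTo-split (f ∘ suc) n y y<n
... | A , B , eq , len = f 0 ∷ A , B , cong (f 0 ∷_) eq , cong suc len

upTo-split-length : ∀ n A {y B} → upTo (suc n) ≡ A ++ y ∷ B → length A + length B ≡ n
upTo-split-length n A {y} {B} eq = suc-injective (trans (sym (+-suc (length A) (length B)))
  (trans (sym (length-++ A)) (trans (cong length (sym eq)) (length-upTo (suc n)))))

-- Two lists without repetition and with the same members are permutations of each other.
-- Representatives of different classes have different canonical words, and a listed word arises
-- from the representative of the class of any preimage.
classes↭words : ∀ n s A y B → upTo (suc n) ≡ A ++ y ∷ B → ∀ L → Transversal (suc n) L →
  map canonicalWord (filter (λ σ → smax σ ℤ.≟ s ◃ suc y) L) ↭ words n s A y B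
classes↭words n s A y B eq L (perms , represented , apart) =
  ∼bag⇒↭ (unique∧set⇒bag uniqueClasses (words-unique n s A y B sorted) (mk⇔ to from))
  where
  smax≟ = λ σ → smax σ ℤ.≟ s ◃ suc y
  sorted : Sorted (A ++ y ∷ B)
  sorted = subst Sorted eq (AllPairs.applyUpTo⁺₁ id (suc n) (λ i<j _ → i<j))
  len = upTo-split-length n A eq

  uniqueClasses : Unique (map canonicalWord (filter smax≟ L))
  uniqueClasses = AllPairs.map⁺ (AllPairs.filter⁺ smax≟
    (allPairs-map (λ p q ¬σ~τ e → ¬σ~τ (canonicalWord-complete p q e)) perms apart))

  to : ∀ {w} → w ∈ map canonicalWord (filter smax≟ L) → w ∈ words n s A y B
  to w∈ with ∈-map⁻ canonicalWord w∈
  ... | σ , σ∈ , refl with ∈-filter⁻ smax≟ {xs = L} σ∈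
  ...   | σ∈L , smaxσ = ∈-words⁺ n s A y B len sorted
    (isWord (trans (sym (canonicalWord-smax p)) smaxσ)
            (subst (λ S → map ∣_∣ (canonicalWord σ) ↭ map suc S) eq (canonicalWord-letters {σ = σ} p))
            (canonicalWord-canonical p))
    where p = All.lookup perms σ∈L

  from : ∀ {w} → w ∈ words n s A y B → w ∈ map canonicalWord (filter smax≟ L)
  from {w} w∈ with ∈-words⁻ n s A y B len sorted w∈
  ... | isWord first letters canonical
    with canonicalWord-surjective (subst (λ S → map ∣_∣ w ↭ map suc S) (sym eq) letters) canonical
  ... | σ , p , refl with represented σ p
  ... | τ , τ∈L , σ~τ = subst (_∈ _) (sym same)
    (∈-map⁺ canonicalWord (∈-filter⁺ smax≟ τ∈L
      (trans (canonicalWord-smax (All.lookup perms τ∈L)) (trans (cong firstLetter (sym same)) first))))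
    where same = canonicalWord-flipEq p σ~τ

classSum-words : ∀ n s A y B → upTo (suc n) ≡ A ++ y ∷ B → ∀ L → Transversal (suc n) L →
                 classSum (suc n) (s ◃ suc y) L ≈L total (suc n) (words n s A y B)
classSum-words n s A y B eq L T e =
  trans (classSum-total (suc n) (All.filter⁺ (λ σ → smax σ ℤ.≟ s ◃ suc y) (proj₁ T)) e)
        (total-↭ (suc n) (classes↭words n s A y B eq L T) e)

theorem2p4 : (n k : ℕ) → 1 ≤ k → k ≤ n → (L : List (List ℤ)) → Transversal n L →
    (V n (+ k) ≈L classSum n (+ (n ∸ k + 1)) L)
    × (V n (- (+ k)) ≈L classSum n (- (+ (n ∸ k + 1))) L)
theorem2p4 (suc n) (suc k) _ (s≤s k≤n) L T with applyUpTo-split id (suc n) (n ∸ k) (s≤s (m∸n≤m n k))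
-- With `n` and `k` lowered by one, the letter sought is n - k + 1, stored as `n ∸ k`. Exactly `k`
-- entries of `upTo (suc n)` exceed it, which gives the index k + 1.
... | A , B , eq , lenA rewrite +-comm (n ∸ k) 1 =
  (λ e → trans (cong (λ c → VP (suc n) (suc c) e) (sym lenB))
               (trans (sym (proj₁ (total-words n A (n ∸ k) B len e)))
                      (sym (classSum-words n Sign.+ A (n ∸ k) B eq L T e)))) ,
  (λ e → trans (cong (λ c → VN (suc n) (suc c) e) (sym lenB))
               (trans (sym (proj₂ (total-words n A (n ∸ k) B len e)))
                      (sym (classSum-words n Sign.- A (n ∸ k) B eq L T e))))
  where
  len = upTo-split-length n A eq
  lenB : length B ≡ k
  lenB = +-cancelˡ-≡ (n ∸ k) (length B) k
           (trans (cong (_+ length B) (sym lenA)) (trans len (sym (m∸n+n≡m k≤n))))
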